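{- Let $G$ be a connected edge-square finite simple graph of order $p$ and size $q$, with normal graph algebra $\mathcal{N}G$ over a field $\mathbb{F}$ of characteristic not $2$. Then $q=p-1$ or $q=p$, and: (1) if $q=p-1$, then $\mathcal{N}G$ is isomorphic (as a normal algebra) to $\mathbb{F}^0\oplus\mathcal{O}_{p-1}$, $\dim\mathrm{ann}\,G=1$, and $G$ is a tree; (2) if $q=p$, then $\mathcal{N}G$ is isomorphic to $\mathcal{O}_p$, $\dim\mathrm{ann}\,G=0$, and $G$ is unicyclic with an odd cycle.
   Context: A normal algebra is a finite-dimensional $\mathbb{F}$-vector space $\mathcal{N}=U\oplus\mathfrak{Z}$ with a commutative bilinear product such that $U\mathfrak{Z}=0$, $\mathfrak{Z}\mathfrak{Z}=0$, $UU\subseteq\mathfrak{Z}$; an isomorphism of normal algebras is a product-preserving linear bijection mapping $U$ onto $U'$ and $\mathfrak{Z}$ onto $\mathfrak{Z}'$; direct sums are taken componentwise. For a finite simple graph $G$ with vertex set $VG$ ($p=|VG|$) and edge set $EG$ ($q=|EG|$), the normal graph algebra $\mathcal{N}G$ has $U=U_G$ with basis $VG$ and $\mathfrak{Z}=\mathfrak{Z}_G$ with basis $EG$ (edge with endpoints $x,y$ written $[x,y]$), with product determined by: for distinct vertices $x,y$, $xy=[x,y]$ if adjacent and $0$ otherwise; $x^2=\sum_{y\sim x}[x,y]$. $G$ is edge-square if for every edge $\mathfrak{e}$ there is $u\in U_G$ with $u^2=\mathfrak{e}$. $\mathrm{ann}\,G=\{u\in U_G: uU_G=0\}$. $\mathbb{F}^0$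 is the normal algebra with $U=\mathbb{F}$, $\mathfrak{Z}=0$ and all products $0$. For $n\ge0$, $\mathcal{O}_n$ is the normal algebra with $U=\langle w_1,\dots,w_n\rangle$, $\mathfrak{Z}=\langle\mathfrak{z}_1,\dots,\mathfrak{z}_n\rangle$ (bases), $w_i^2=\mathfrak{z}_i$, $w_iw_j=0$ for $i\ne j$, and all other basis products $0$. A unicyclic graph is a connected graph with exactly one cycle. -}

module Defs where

open import Algebra.Apartness.Bundles using (HeytingField; HeytingCommutativeRing)
open import Algebra.Bundles using (CommutativeRing)
open import Algebra.Core using (Op₂)
import Algebra.Definitions
open import Algebra.Module.Bundles using (Module)
open import Algebra.Module.Construct.DirectProduct using () renaming (⟨module⟩ to _×ᴹ_)
open import Algebra.Module.Construct.TensorUnit using () renaming (⟨module⟩ to scalars)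
open import Algebra.Module.Morphism.Structures using (IsModuleIsomorphism)
open import Algebra.Module.Structures.Biased using (IsModuleFromLeft)
open import Algebra.Construct.Pointwise using (isAbelianGroup)
open import Algebra.Structures using (IsAbelianGroup)
import Algebra.Properties.CommutativeMonoid.Sum
import Algebra.Properties.Semiring.Sum
open import Data.Bool.Base using (if_then_else_)
open import Data.Fin.Base using (Fin; zero; suc; inject₁; fromℕ; _↑ˡ_; _↑ʳ_; splitAt; join) renaming (_<_ to _<ᶠ_)
open import Data.Fin.Properties using (_≟_; any?; <-asym; splitAt-↑ˡ; splitAt-↑ʳ; join-splitAt)
open import Data.Nat.Base using (ℕ; zero; suc; _+_; _%_; NonZero)
open import Data.Product.Base using (Σ; ∃; ∃₂; _×_; _,_; proj₁; proj₂)
open import Data.Sum.Base using (_⊎_; inj₁; inj₂; swap)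
open import Data.Unit.Polymorphic.Base using (⊤)
open import Data.Vec.Functional using (Vector; _++_)
open import Function.Base using (_∘_)
open import Function.Bundles using (_⇔_)
open import Function.Definitions using (Injective)
open import Level using (Level; _⊔_) renaming (suc to lsuc)
open import Relation.Binary.Construct.Closure.ReflexiveTransitive using (Star)
open import Relation.Binary.PropositionalEquality.Core as ≡ using (_≡_)
open import Relation.Nullary.Decidable.Core using (Dec; yes; no; does; _×-dec_; _⊎-dec_)
open import Relation.Nullary.Negation.Core using (¬_; contradiction)
open import Relation.Unary using (Pred)

private
  variable
    c ℓ ℓ₁ ℓ₂ m m′ ℓm ℓm′ s s′ : Level

record Subspace {R : CommutativeRing c ℓ} (M : Module R m ℓm) s
                : Set (c ⊔ m ⊔ ℓm ⊔ lsuc s) where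
  open CommutativeRing R using (Carrier)
  open Module M
  field
    Member    : Pred Carrierᴹ s
    respects  : ∀ {x y} → x ≈ᴹ y → Member x → Member y
    0-closed  : Member 0ᴹ
    +-closed  : ∀ {x y} → Member x → Member y → Member (x +ᴹ y)
    *ₗ-closed : ∀ (a : Carrier) {x} → Member x → Member (a *ₗ x)

infix 4 _∈_
_∈_ : {R : CommutativeRing c ℓ} {M : Module R m ℓm} →
      Module.Carrierᴹ M → Subspace M s → Set s
x ∈ S = Subspace.Member S x

module _ {R : CommutativeRing c ℓ} (M : Module R m ℓm) where
  open Module M

  whole : ∀ s → Subspace M s
  whole s = record
    { Member = λ _ → ⊤ ; respects = λ _ _ → _ ; 0-closed = _
    ; +-closed = λ _ _ → _ ; *ₗ-closed = λ _ _ → _ }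

  zeroSubspace : Subspace M ℓm
  zeroSubspace = record
    { Member    = _≈ᴹ 0ᴹ
    ; respects  = λ x≈y x≈0 → ≈ᴹ-trans (≈ᴹ-sym x≈y) x≈0
    ; 0-closed  = ≈ᴹ-refl
    ; +-closed  = λ x≈0 y≈0 → ≈ᴹ-trans (+ᴹ-cong x≈0 y≈0) (+ᴹ-identityˡ 0ᴹ)
    ; *ₗ-closed = λ a x≈0 → ≈ᴹ-trans (*ₗ-cong (CommutativeRing.refl R) x≈0) (*ₗ-zeroʳ a)
    }

_×ˢ_ : {R : CommutativeRing c ℓ} {M : Module R m ℓm} {N : Module R m′ ℓm′} →
       Subspace M s → Subspace N s′ → Subspace (M ×ᴹ N) (s ⊔ s′)
S ×ˢ T = record
  { Member    = λ (x , y) → x ∈ S × y ∈ T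
  ; respects  = λ (p , q) (x , y) → S.respects p x , T.respects q y
  ; 0-closed  = S.0-closed , T.0-closed
  ; +-closed  = λ (x , y) (x′ , y′) → S.+-closed x x′ , T.+-closed y y′
  ; *ₗ-closed = λ a (x , y) → S.*ₗ-closed a x , T.*ₗ-closed a y
  }
  where
  module S = Subspace S
  module T = Subspace T

module _ {R : CommutativeRing c ℓ} {M : Module R m ℓm} where
  open CommutativeRing R using (Carrier; _≈_; 0#)
  open Module M
  open Algebra.Properties.CommutativeMonoid.Sum +ᴹ-commutativeMonoid using (sum)

  linearCombination : ∀ {n} → Vector Carrier n → Vector Carrierᴹ n → Carrierᴹ
  linearCombination a b = sum λ i → a i *ₗ b i

  record IsBasis {n} (S : Subspace M s) (b : Vector Carrierᴹ n)
                 : Set (c ⊔ ℓ ⊔ m ⊔ ℓm ⊔ s) where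
    field
      member      : ∀ i → b i ∈ S
      independent : ∀ a → linearCombination a b ≈ᴹ 0ᴹ → ∀ i → a i ≈ 0#
      spanning    : ∀ x → x ∈ S → ∃ λ a → x ≈ᴹ linearCombination a b

  HasDimension : Subspace M s → ℕ → Set (c ⊔ ℓ ⊔ m ⊔ ℓm ⊔ s)
  HasDimension S n = Σ (Vector Carrierᴹ n) (IsBasis S)

FiniteDimensional : {R : CommutativeRing c ℓ} → Module R m ℓm → Set (c ⊔ ℓ ⊔ m ⊔ ℓm)
FiniteDimensional {ℓm = ℓm} M = ∃ (HasDimension (whole M ℓm))

module _ {R : CommutativeRing c ℓ} (M : Module R m ℓm) (N : Module R m′ ℓm′) where
  private
    module M = Module M
    module N = Module N
    module P = Module (M ×ᴹ N)
    module ΣM = Algebra.Properties.CommutativeMonoid.Sum M.+ᴹ-commutativeMonoid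
    module ΣN = Algebra.Properties.CommutativeMonoid.Sum N.+ᴹ-commutativeMonoid
    module ΣP = Algebra.Properties.CommutativeMonoid.Sum P.+ᴹ-commutativeMonoid
    open CommutativeRing R using (Carrier)

    sum-split : ∀ k {l} (f : Vector P.Carrierᴹ (k + l)) →
                ΣP.sum f P.≈ᴹ (ΣP.sum (f ∘ (_↑ˡ l)) P.+ᴹ ΣP.sum (f ∘ (k ↑ʳ_)))
    sum-split zero    f = P.≈ᴹ-sym (P.+ᴹ-identityˡ _)
    sum-split (suc k) f = P.≈ᴹ-trans (P.+ᴹ-cong P.≈ᴹ-refl (sum-split k (f ∘ suc)))
                                     (P.≈ᴹ-sym (P.+ᴹ-assoc _ _ _))

    sum-left : ∀ {k} (a : Vector Carrier k) (b : Vector M.Carrierᴹ k) →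
               ΣP.sum (λ i → a i P.*ₗ (b i , N.0ᴹ)) P.≈ᴹ (linearCombination {M = M} a b , N.0ᴹ)
    sum-left {zero}  a b = P.≈ᴹ-refl
    sum-left {suc k} a b = P.≈ᴹ-trans (P.+ᴹ-cong P.≈ᴹ-refl (sum-left (a ∘ suc) (b ∘ suc)))
      (M.≈ᴹ-refl , N.≈ᴹ-trans (N.+ᴹ-identityʳ _) (N.*ₗ-zeroʳ _))

    sum-right : ∀ {k} (a : Vector Carrier k) (b : Vector N.Carrierᴹ k) →
                ΣP.sum (λ i → a i P.*ₗ (M.0ᴹ , b i)) P.≈ᴹ (M.0ᴹ , linearCombination {M = N} a b)
    sum-right {zero}  a b = P.≈ᴹ-refl
    sum-right {suc k} a b = P.≈ᴹ-trans (P.+ᴹ-cong P.≈ᴹ-refl (sum-right (a ∘ suc) (b ∘ suc)))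
      (M.≈ᴹ-trans (M.+ᴹ-identityʳ _) (M.*ₗ-zeroʳ _) , N.≈ᴹ-refl)

  finiteDimensional-× : FiniteDimensional M → FiniteDimensional N → FiniteDimensional (M ×ᴹ N)
  finiteDimensional-× (k , bM , B) (l , bN , C) = k + l , b , record
    { member      = λ _ → _
    ; independent = independent
    ; spanning    = spanning
    }
    where
    module B = IsBasis B
    module C = IsBasis C

    bM′ : Vector P.Carrierᴹ k
    bM′ i = bM i , N.0ᴹ

    bN′ : Vector P.Carrierᴹ l
    bN′ i = M.0ᴹ , bN i

    b : Vector P.Carrierᴹ (k + l)
    b = bM′ ++ bN′

    b-left : ∀ i → b (i ↑ˡ l) ≡ bM′ i
    b-left i rewrite splitAt-↑ˡ k i l = ≡.refl

    b-right : ∀ i → b (k ↑ʳ i) ≡ bN′ i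
    b-right i rewrite splitAt-↑ʳ k l i = ≡.refl

    combination : ∀ a → linearCombination {M = M ×ᴹ N} a b P.≈ᴹ
      (linearCombination {M = M} (a ∘ (_↑ˡ l)) bM , linearCombination {M = N} (a ∘ (k ↑ʳ_)) bN)
    combination a =
      P.≈ᴹ-trans (sum-split k (λ i → a i P.*ₗ b i)) (P.≈ᴹ-trans
        (P.+ᴹ-cong
          (P.≈ᴹ-trans (P.≈ᴹ-reflexive (ΣP.sum-cong-≗ λ i → ≡.cong (a (i ↑ˡ l) P.*ₗ_) (b-left i)))
                      (sum-left (a ∘ (_↑ˡ l)) bM))
          (P.≈ᴹ-trans (P.≈ᴹ-reflexive (ΣP.sum-cong-≗ λ i → ≡.cong (a (k ↑ʳ i) P.*ₗ_) (b-right i)))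
                      (sum-right (a ∘ (k ↑ʳ_)) bN)))
        (M.+ᴹ-identityʳ _ , N.+ᴹ-identityˡ _))

    independent : ∀ a → linearCombination {M = M ×ᴹ N} a b P.≈ᴹ P.0ᴹ →
                  ∀ i → CommutativeRing._≈_ R (a i) (CommutativeRing.0# R)
    independent a a·b≈0 i = ≡.subst (λ j → CommutativeRing._≈_ R (a j) (CommutativeRing.0# R))
                                    (join-splitAt k l i) (coordinate (splitAt k i))
      where
      both = P.≈ᴹ-trans (P.≈ᴹ-sym (combination a)) a·b≈0
      coordinate : ∀ t → CommutativeRing._≈_ R (a (join k l t)) (CommutativeRing.0# R)
      coordinate (inj₁ i) = B.independent (a ∘ (_↑ˡ l)) (proj₁ both) i
      coordinate (inj₂ i) = C.independent (a ∘ (k ↑ʳ_)) (proj₂ both) i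

    spanning : ∀ x → x ∈ whole (M ×ᴹ N) (ℓm ⊔ ℓm′) →
               ∃ λ a → x P.≈ᴹ linearCombination {M = M ×ᴹ N} a b
    spanning (x , y) _ = a₁ ++ a₂ , P.≈ᴹ-sym (P.≈ᴹ-trans (combination (a₁ ++ a₂))
        ( M.≈ᴹ-trans (M.≈ᴹ-reflexive (ΣM.sum-cong-≗ λ i → ≡.cong (M._*ₗ bM i) (a-left i)))
                     (M.≈ᴹ-sym (proj₂ (B.spanning x _)))
        , N.≈ᴹ-trans (N.≈ᴹ-reflexive (ΣN.sum-cong-≗ λ i → ≡.cong (N._*ₗ bN i) (a-right i)))
                     (N.≈ᴹ-sym (proj₂ (C.spanning y _)))))
      where
      a₁ = proj₁ (B.spanning x _)
      a₂ = proj₁ (C.spanning y _)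
      a-left : ∀ i → (a₁ ++ a₂) (i ↑ˡ l) ≡ a₁ i
      a-left i rewrite splitAt-↑ˡ k i l = ≡.refl
      a-right : ∀ i → (a₁ ++ a₂) (k ↑ʳ i) ≡ a₂ i
      a-right i rewrite splitAt-↑ʳ k l i = ≡.refl

module _ (R : CommutativeRing c ℓ) where
  open CommutativeRing R hiding (zero) renaming (_+_ to _+ᴿ_)
  open Algebra.Properties.Semiring.Sum semiring

  coordinateSpace : ℕ → Module R c ℓ
  coordinateSpace n = record
    { Carrierᴹ = Vector Carrier n
    ; _≈ᴹ_     = λ u v → ∀ i → u i ≈ v i
    ; _+ᴹ_     = λ u v i → u i +ᴿ v i
    ; _*ₗ_     = λ a u i → a * u i
    ; _*ᵣ_     = λ u a i → a * u i
    ; 0ᴹ       = λ _ → 0#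
    ; -ᴹ_      = λ u i → - u i
    ; isModule = IsModuleFromLeft.isModule record
      { isLeftModule = record
        { isLeftSemimodule = record
          { +ᴹ-isCommutativeMonoid = IsAbelianGroup.isCommutativeMonoid +ᴹ
          ; isPreleftSemimodule = record
            { *ₗ-cong      = λ a≈b u≈v i → *-cong a≈b (u≈v i)
            ; *ₗ-zeroˡ     = λ u i → zeroˡ (u i)
            ; *ₗ-distribʳ  = λ u a b i → distribʳ (u i) a b
            ; *ₗ-identityˡ = λ u i → *-identityˡ (u i)
            ; *ₗ-assoc     = λ a b u i → *-assoc a b (u i)
            ; *ₗ-zeroʳ     = λ a i → zeroʳ a
            ; *ₗ-distribˡ  = λ a u v i → distribˡ a (u i) (v i)
            }
          }
        ; -ᴹ‿cong    = IsAbelianGroup.⁻¹-cong +ᴹ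
        ; -ᴹ‿inverse = IsAbelianGroup.inverse +ᴹ
        }
      }
    }
    where
    +ᴹ = isAbelianGroup (Fin n) +-isAbelianGroup

  δ : ∀ {n} → Fin n → Vector Carrier n
  δ i j = if does (i ≟ j) then 1# else 0#

  private
    sum-pointwise : ∀ {n k} (f : Vector (Vector Carrier k) n) (j : Fin k) →
      Algebra.Properties.CommutativeMonoid.Sum.sum (Module.+ᴹ-commutativeMonoid (coordinateSpace k)) f j
      ≡ sum (λ i → f i j)
    sum-pointwise {zero}  f j = ≡.refl
    sum-pointwise {suc n} f j = ≡.cong (f zero j +ᴿ_) (sum-pointwise (f ∘ suc) j)

    sum-zero : ∀ {n} (f : Vector Carrier n) → (∀ i → f i ≈ 0#) → sum f ≈ 0#
    sum-zero {n} f f≈0 = trans (sum-cong-≋ f≈0) (sum-replicate-zero n)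

    sum-δ : ∀ {n} (a : Vector Carrier n) j → sum (λ i → a i * δ i j) ≈ a j
    sum-δ {suc n} a zero = trans
      (+-cong (*-identityʳ _) (sum-zero (λ i → a (suc i) * 0#) λ i → zeroʳ _)) (+-identityʳ _)
    sum-δ {suc n} a (suc j) =
      trans (+-cong (zeroʳ _) (sum-δ (a ∘ suc) j)) (+-identityˡ _)

    combination-δ : ∀ {n} (a : Vector Carrier n) j →
                    linearCombination {M = coordinateSpace n} a δ j ≈ a j
    combination-δ a j = trans (reflexive (sum-pointwise (λ i k → a i * δ i k) j)) (sum-δ a j)

  coordinateSpace-dimension : ∀ n → HasDimension (whole (coordinateSpace n) ℓ) n
  coordinateSpace-dimension n = δ , record
    { member      = λ _ → _
    ; independent = λ a a·δ≈0 i → trans (sym (combination-δ a i)) (a·δ≈0 i)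
    ; spanning    = λ x _ → x , λ i → sym (combination-δ x i)
    }

  scalars-dimension : HasDimension (whole (scalars {R = R}) ℓ) 1
  scalars-dimension = (λ _ → 1#) , record
    { member      = λ _ → _
    ; independent = λ { a a·1≈0 zero → trans (sym (combination a)) a·1≈0 }
    ; spanning    = λ x _ → (λ _ → x) , sym (combination λ _ → x)
    }
    where
    combination : (a : Vector Carrier 1) → a zero * 1# +ᴿ 0# ≈ a zero
    combination a = trans (+-identityʳ _) (*-identityʳ _)

-- The standard library's notion of field.  Equality need not be decidable;
-- taking x # y to be ¬ x ≈ y, every field with decidable equality is one.
fieldRing : HeytingField c ℓ₁ ℓ₂ → CommutativeRing c ℓ₁
fieldRing F = HeytingCommutativeRing.commutativeRing (HeytingField.heytingCommutativeRing F)

record NormalAlgebra (F : HeytingField c ℓ₁ ℓ₂) m ℓm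
                     : Set (c ⊔ ℓ₁ ⊔ lsuc (m ⊔ ℓm)) where
  infixl 7 _·_
  field
    space             : Module (fieldRing F) m ℓm
    finiteDimensional : FiniteDimensional space

  open Module space public
  open Algebra.Definitions _≈ᴹ_

  field
    U Z          : Subspace space ℓm
    decompose    : ∀ x → ∃₂ λ u z → u ∈ U × z ∈ Z × x ≈ᴹ u +ᴹ z
    U∩Z≈0        : ∀ x → x ∈ U → x ∈ Z → x ≈ᴹ 0ᴹ
    _·_          : Op₂ Carrierᴹ
    ·-cong       : Congruent₂ _·_
    ·-comm       : Commutative _·_
    ·-distribʳ-+ : _·_ DistributesOverʳ _+ᴹ_
    *ₗ-·-assoc   : ∀ a x y → (a *ₗ x) · y ≈ᴹ a *ₗ (x · y)
    U·Z≈0        : ∀ {x y} → x ∈ U → y ∈ Z → x · y ≈ᴹ 0ᴹ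
    Z·Z≈0        : ∀ {x y} → x ∈ Z → y ∈ Z → x · y ≈ᴹ 0ᴹ
    U·U⊆Z        : ∀ {x y} → x ∈ U → y ∈ U → x · y ∈ Z

module _ {F : HeytingField c ℓ₁ ℓ₂} where

  infix 4 _≅_
  record _≅_ (A : NormalAlgebra F m ℓm) (B : NormalAlgebra F m′ ℓm′)
             : Set (c ⊔ m ⊔ ℓm ⊔ m′ ⊔ ℓm′) where
    private
      module A = NormalAlgebra A
      module B = NormalAlgebra B
    field
      to           : A.Carrierᴹ → B.Carrierᴹ
      isLinearIso  : IsModuleIsomorphism A.rawModule B.rawModule to
      ·-homo       : ∀ x y → to (x A.· y) B.≈ᴹ to x B.· to y
      U-into       : ∀ {x} → x ∈ A.U → to x ∈ B.U
      U-onto       : ∀ {y} → y ∈ B.U → ∃ λ x → x ∈ A.U × to x B.≈ᴹ y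
      Z-into       : ∀ {x} → x ∈ A.Z → to x ∈ B.Z
      Z-onto       : ∀ {y} → y ∈ B.Z → ∃ λ x → x ∈ A.Z × to x B.≈ᴹ y

  infixr 6 _⊕_
  _⊕_ : NormalAlgebra F m ℓm → NormalAlgebra F m′ ℓm′ → NormalAlgebra F (m ⊔ m′) (ℓm ⊔ ℓm′)
  A ⊕ B = record
    { space             = A.space ×ᴹ B.space
    ; finiteDimensional = finiteDimensional-× A.space B.space A.finiteDimensional B.finiteDimensional
    ; U                 = A.U ×ˢ B.U
    ; Z                 = A.Z ×ˢ B.Z
    ; decompose         = λ (x , y) →
        let u , z , u∈U , z∈Z , x≈u+z = A.decompose x
            v , w , v∈U , w∈Z , y≈v+w = B.decompose y
        in (u , v) , (z , w) , (u∈U , v∈U) , (z∈Z , w∈Z) , (x≈u+z , y≈v+w)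
    ; U∩Z≈0             = λ (x , y) (p , q) (r , s) → A.U∩Z≈0 x p r , B.U∩Z≈0 y q s
    ; _·_               = λ (x , y) (x′ , y′) → x A.· x′ , y B.· y′
    ; ·-cong            = λ (p , q) (r , s) → A.·-cong p r , B.·-cong q s
    ; ·-comm            = λ (x , y) (x′ , y′) → A.·-comm x x′ , B.·-comm y y′
    ; ·-distribʳ-+      = λ (x , y) (x′ , y′) (x″ , y″) →
                            A.·-distribʳ-+ x x′ x″ , B.·-distribʳ-+ y y′ y″
    ; *ₗ-·-assoc        = λ a (x , y) (x′ , y′) → A.*ₗ-·-assoc a x x′ , B.*ₗ-·-assoc a y y′
    ; U·Z≈0             = λ (p , q) (r , s) → A.U·Z≈0 p r , B.U·Z≈0 q s
    ; Z·Z≈0             = λ (p , q) (r , s) → A.Z·Z≈0 p r , B.Z·Z≈0 q s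
    ; U·U⊆Z             = λ (p , q) (r , s) → A.U·U⊆Z p r , B.U·U⊆Z q s
    }
    where
    module A = NormalAlgebra A
    module B = NormalAlgebra B

  annihilator : (A : NormalAlgebra F m ℓm) → Subspace (NormalAlgebra.space A) (m ⊔ ℓm)
  annihilator A = record
    { Member    = λ u → u ∈ U × (∀ v → v ∈ U → u · v ≈ᴹ 0ᴹ)
    ; respects  = λ {x} {y} x≈y (x∈U , x·U≈0) → Subspace.respects U x≈y x∈U , λ v v∈U →
        ≈ᴹ-trans (·-cong (≈ᴹ-sym x≈y) (≈ᴹ-refl {v})) (x·U≈0 v v∈U)
    ; 0-closed  = Subspace.0-closed U , λ v v∈U →
        ≈ᴹ-trans (·-comm 0ᴹ v) (U·Z≈0 v∈U (Subspace.0-closed Z))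
    ; +-closed  = λ {x} {y} (x∈U , x·U≈0) (y∈U , y·U≈0) → Subspace.+-closed U x∈U y∈U , λ v v∈U →
        ≈ᴹ-trans (·-distribʳ-+ v x y)
          (≈ᴹ-trans (+ᴹ-cong (x·U≈0 v v∈U) (y·U≈0 v v∈U)) (+ᴹ-identityˡ 0ᴹ))
    ; *ₗ-closed = λ a {x} (x∈U , x·U≈0) → Subspace.*ₗ-closed U a x∈U , λ v v∈U →
        ≈ᴹ-trans (*ₗ-·-assoc a x v)
          (≈ᴹ-trans (*ₗ-cong (CommutativeRing.refl (fieldRing F)) (x·U≈0 v v∈U)) (*ₗ-zeroʳ a))
    }
    where open NormalAlgebra A

module _ (F : HeytingField c ℓ₁ ℓ₂) where
  private
    R = fieldRing F
  open CommutativeRing R hiding (zero) renaming (_+_ to _+ᴿ_)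
  open Algebra.Properties.Semiring.Sum semiring

  𝔽⁰ : NormalAlgebra F c ℓ₁
  𝔽⁰ = record
    { space             = scalars
    ; finiteDimensional = 1 , scalars-dimension R
    ; U                 = whole scalars ℓ₁
    ; Z                 = zeroSubspace scalars
    ; decompose         = λ x → x , 0# , _ , refl , sym (+-identityʳ x)
    ; U∩Z≈0             = λ _ _ x≈0 → x≈0
    ; _·_               = λ _ _ → 0#
    ; ·-cong            = λ _ _ → refl
    ; ·-comm            = λ _ _ → refl
    ; ·-distribʳ-+      = λ _ _ _ → sym (+-identityʳ 0#)
    ; *ₗ-·-assoc        = λ a _ _ → sym (zeroʳ a)
    ; U·Z≈0             = λ _ _ → refl
    ; Z·Z≈0             = λ _ _ → refl
    ; U·U⊆Z             = λ _ _ → refl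
    }

  bilinearExtension : ∀ {m n} → (Fin m → Fin m → Vector Carrier n) →
                      Vector Carrier m → Vector Carrier m → Vector Carrier n
  bilinearExtension {m} β u v e = ∑[ i < m ] ∑[ j < m ] (u i * v j * β i j e)

  -- U = 𝔽ᵐ and Z = 𝔽ⁿ with their standard bases; β i j is the product of the
  -- i-th and j-th basis vectors of U.
  normalAlgebra : ∀ {m n} (β : Fin m → Fin m → Vector Carrier n) →
                  (∀ i j e → β i j e ≈ β j i e) → NormalAlgebra F c ℓ₁
  normalAlgebra {m} {n} β β-sym = record
    { space             = coordinateSpace R m ×ᴹ coordinateSpace R n
    ; finiteDimensional = finiteDimensional-× (coordinateSpace R m) (coordinateSpace R n)
                            (m , coordinateSpace-dimension R m) (n , coordinateSpace-dimension R n)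
    ; U                 = whole (coordinateSpace R m) ℓ₁ ×ˢ zeroSubspace (coordinateSpace R n)
    ; Z                 = zeroSubspace (coordinateSpace R m) ×ˢ whole (coordinateSpace R n) ℓ₁
    ; decompose         = λ (u , z) → (u , λ _ → 0#) , ((λ _ → 0#) , z)
                                    , (_ , λ _ → refl) , ((λ _ → refl) , _)
                                    , (λ i → sym (+-identityʳ _)) , (λ e → sym (+-identityˡ _))
    ; U∩Z≈0             = λ _ (_ , z≈0) (u≈0 , _) → u≈0 , z≈0
    ; _·_               = λ (u , _) (v , _) → (λ _ → 0#) , u ⋆ v
    ; ·-cong            = λ (u≈u′ , _) (v≈v′ , _) → (λ _ → refl) , ⋆-cong u≈u′ v≈v′
    ; ·-comm            = λ (u , _) (v , _) → (λ _ → refl) , ⋆-comm u v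
    ; ·-distribʳ-+      = λ (w , _) (u , _) (v , _) →
                            (λ _ → sym (+-identityʳ 0#)) , ⋆-distribʳ w u v
    ; *ₗ-·-assoc        = λ a (u , _) (v , _) → (λ _ → sym (zeroʳ a)) , ⋆-scale a u v
    ; U·Z≈0             = λ {(u , _)} {(v , _)} _ (v≈0 , _) → (λ _ → refl) , ⋆-zeroʳ u v v≈0
    ; Z·Z≈0             = λ {(u , _)} {(v , _)} _ (v≈0 , _) → (λ _ → refl) , ⋆-zeroʳ u v v≈0
    ; U·U⊆Z             = λ _ _ → (λ _ → refl) , _
    }
    where
    _⋆_ : Vector Carrier m → Vector Carrier m → Vector Carrier n
    _⋆_ = bilinearExtension β

    ∑∑-cong : {f g : Fin m → Fin m → Carrier} → (∀ i j → f i j ≈ g i j) →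
              ∑[ i < m ] ∑[ j < m ] f i j ≈ ∑[ i < m ] ∑[ j < m ] g i j
    ∑∑-cong f≈g = sum-cong-≋ λ i → sum-cong-≋ λ j → f≈g i j

    ⋆-cong : ∀ {u u′ v v′} → (∀ i → u i ≈ u′ i) → (∀ i → v i ≈ v′ i) →
             ∀ e → (u ⋆ v) e ≈ (u′ ⋆ v′) e
    ⋆-cong u≈u′ v≈v′ e = ∑∑-cong λ i j → *-congʳ (*-cong (u≈u′ i) (v≈v′ j))

    ⋆-comm : ∀ u v e → (u ⋆ v) e ≈ (v ⋆ u) e
    ⋆-comm u v e = trans (∑-comm λ i j → u i * v j * β i j e)
                         (∑∑-cong λ i j → *-cong (*-comm (u j) (v i)) (β-sym j i e))

    ⋆-distribʳ : ∀ w u v e → ((λ i → u i +ᴿ v i) ⋆ w) e ≈ (u ⋆ w) e +ᴿ (v ⋆ w) e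
    ⋆-distribʳ w u v e = trans
      (sum-cong-≋ λ i → trans
        (sum-cong-≋ λ j → trans (*-congʳ (distribʳ (w j) (u i) (v i)))
                                (distribʳ (β i j e) (u i * w j) (v i * w j)))
        (∑-distrib-+ (λ j → u i * w j * β i j e) (λ j → v i * w j * β i j e)))
      (∑-distrib-+ (λ i → ∑[ j < m ] (u i * w j * β i j e)) (λ i → ∑[ j < m ] (v i * w j * β i j e)))

    ⋆-scale : ∀ a u v e → ((λ i → a * u i) ⋆ v) e ≈ a * (u ⋆ v) e
    ⋆-scale a u v e = sym (trans
      (*-distribˡ-sum a λ i → ∑[ j < m ] (u i * v j * β i j e))
      (sum-cong-≋ λ i → trans
        (*-distribˡ-sum a λ j → u i * v j * β i j e)
        (sum-cong-≋ λ j → trans (sym (*-assoc a (u i * v j) (β i j e)))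
                                (*-congʳ (sym (*-assoc a (u i) (v j)))))))

    ⋆-zeroʳ : ∀ u v → (∀ i → v i ≈ 0#) → ∀ e → (u ⋆ v) e ≈ 0#
    ⋆-zeroʳ u v v≈0 e = sum-zero λ i → sum-zero λ j →
      trans (*-congʳ (trans (*-congˡ (v≈0 j)) (zeroʳ (u i)))) (zeroˡ _)
      where
      sum-zero : ∀ {k} {f : Vector Carrier k} → (∀ i → f i ≈ 0#) → sum f ≈ 0#
      sum-zero {k} f≈0 = trans (sum-cong-≋ f≈0) (sum-replicate-zero k)

  orthogonalProduct : ∀ {n} → Fin n → Fin n → Vector Carrier n
  orthogonalProduct i j with i ≟ j
  ... | yes _ = δ R i
  ... | no  _ = λ _ → 0#

  private
    orthogonalProduct-sym : ∀ {n} (i j e : Fin n) → orthogonalProduct i j e ≈ orthogonalProduct j i e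
    orthogonalProduct-sym i j e with i ≟ j | j ≟ i
    ... | yes ≡.refl | yes _   = refl
    ... | yes i≡j    | no  j≢i = contradiction (≡.sym i≡j) j≢i
    ... | no  i≢j    | yes j≡i = contradiction (≡.sym j≡i) i≢j
    ... | no  _      | no  _   = refl

  𝒪 : ℕ → NormalAlgebra F c ℓ₁
  𝒪 n = normalAlgebra (orthogonalProduct {n}) orthogonalProduct-sym

-- A finite simple graph with vertex set Fin p and edge set Fin q.  An edge is
-- a two-element set of vertices, stored with its smaller element first.
record Graph (p q : ℕ) : Set where
  field
    end₁ end₂     : Fin q → Fin p
    ordered       : ∀ e → end₁ e <ᶠ end₂ e
    noMultiEdges  : ∀ {e f} → end₁ e ≡ end₁ f → end₂ e ≡ end₂ f → e ≡ f

  Joins : Fin q → Fin p → Fin p → Set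
  Joins e x y = (end₁ e ≡ x × end₂ e ≡ y) ⊎ (end₁ e ≡ y × end₂ e ≡ x)

  Adjacent : Fin p → Fin p → Set
  Adjacent x y = ∃ λ e → Joins e x y

  adjacent? : ∀ x y → Dec (Adjacent x y)
  adjacent? x y = any? λ e → ((end₁ e ≟ x) ×-dec (end₂ e ≟ y)) ⊎-dec ((end₁ e ≟ y) ×-dec (end₂ e ≟ x))

  joins-unique : ∀ {e f x y} → Joins e x y → Joins f x y → e ≡ f
  joins-unique (inj₁ (≡.refl , ≡.refl)) (inj₁ (p , q)) = noMultiEdges (≡.sym p) (≡.sym q)
  joins-unique (inj₂ (≡.refl , ≡.refl)) (inj₂ (p , q)) = noMultiEdges (≡.sym p) (≡.sym q)
  joins-unique {e} {f} (inj₁ (≡.refl , ≡.refl)) (inj₂ (p , q)) =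
    contradiction (≡.subst₂ _<ᶠ_ p q (ordered f)) (<-asym (ordered e))
  joins-unique {e} {f} (inj₂ (≡.refl , ≡.refl)) (inj₁ (p , q)) =
    contradiction (≡.subst₂ _<ᶠ_ p q (ordered f)) (<-asym (ordered e))

module _ {p q : ℕ} (G : Graph p q) where
  open Graph G

  -- The empty graph does not count as connected.
  Connected : Set
  Connected = NonZero p × (∀ x y → Star Adjacent x y)

  record Cycle : Set where
    field
      length-3 : ℕ

    length : ℕ
    length = 3 + length-3

    field
      vertex    : Fin length → Fin p
      injective : Injective _≡_ _≡_ vertex
      step      : ∀ i → Adjacent (vertex (inject₁ i)) (vertex (suc i))
      close     : Adjacent (vertex (fromℕ _)) (vertex zero)

    Contains : Fin q → Set
    Contains e = (∃ λ i → Joins e (vertex (inject₁ i)) (vertex (suc i)))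
               ⊎ Joins e (vertex (fromℕ _)) (vertex zero)

  -- A cycle is a subgraph: the starting vertex and the direction of traversal
  -- do not matter, so cycles are compared by their edges.
  SameCycle : Cycle → Cycle → Set
  SameCycle C D = ∀ e → Cycle.Contains C e ⇔ Cycle.Contains D e

  IsTree : Set
  IsTree = Connected × ¬ Cycle

  Unicyclic : Set
  Unicyclic = Connected × (∃ λ C → ∀ D → SameCycle C D)

  HasOddCycle : Set
  HasOddCycle = ∃ λ (C : Cycle) → Cycle.length C % 2 ≡ 1

module _ (F : HeytingField c ℓ₁ ℓ₂) {p q : ℕ} (G : Graph p q) where
  private
    R = fieldRing F
  open CommutativeRing R using (Carrier; _≈_; 0#; refl; reflexive)
  open Algebra.Properties.Semiring.Sum (CommutativeRing.semiring R) using (sum-syntax)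
  open Graph G

  -- [x,y] if x and y are adjacent, and 0 otherwise
  bracket : Fin p → Fin p → Vector Carrier q
  bracket x y with adjacent? x y
  ... | yes (e , _) = δ R e
  ... | no  _       = λ _ → 0#

  vertexProduct : Fin p → Fin p → Vector Carrier q
  vertexProduct x y with x ≟ y
  ... | yes _ = λ e → ∑[ z < p ] bracket x z e
  ... | no  _ = bracket x y

  private
    bracket-sym : ∀ x y → bracket x y ≡ bracket y x
    bracket-sym x y with adjacent? x y | adjacent? y x
    ... | yes (e , j) | yes (f , k) = ≡.cong (δ R) (joins-unique j (swap k))
    ... | yes (e , j) | no  ¬yx     = contradiction (e , swap j) ¬yx
    ... | no  ¬xy     | yes (f , k) = contradiction (f , swap k) ¬xy
    ... | no  _       | no  _       = ≡.refl

    vertexProduct-sym : ∀ x y e → vertexProduct x y e ≈ vertexProduct y x e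
    vertexProduct-sym x y e with x ≟ y | y ≟ x
    ... | yes ≡.refl | yes _   = refl
    ... | yes x≡y    | no  y≢x = contradiction (≡.sym x≡y) y≢x
    ... | no  x≢y    | yes y≡x = contradiction (≡.sym y≡x) x≢y
    ... | no  _      | no  _   = reflexive (≡.cong (λ b → b e) (bracket-sym x y))

  𝒩 : NormalAlgebra F c ℓ₁
  𝒩 = normalAlgebra F vertexProduct vertexProduct-sym

  open NormalAlgebra 𝒩

  edge : Fin q → Carrierᴹ
  edge e = (λ _ → 0#) , δ R e

  EdgeSquare : Set (c ⊔ ℓ₁)
  EdgeSquare = ∀ e → ∃ λ u → u ∈ U × u · u ≈ᴹ edge e

  ann : Subspace space (c ⊔ ℓ₁)
  ann = annihilator 𝒩

{-# OPTIONS --safe #-}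

-- In 𝒩 G the product of u, v ∈ U has e-coordinate (T u e)(T v e), where T u e is
-- the sum of u over the two ends of e; so G is edge-square exactly when T : U → Z
-- is onto.  A kernel vector changes sign along every edge, and G is connected, so
-- u ↦ (u r , T u) is injective for every vertex r; hence q ≤ p ≤ q + 1.  If
-- p = q + 1, the projection to ker T along a section of T has trace 1, which
-- yields a nonzero kernel vector; if p = q, the kernel is 0 by dimension.
--
-- A preimage of an edge of a cycle shows that every cycle is odd, and a vector
-- that changes sign along all edges of an odd cycle vanishes on it.  Hence there
-- is no cycle if ker T ≠ 0, and at most one in general.  If p = q, a cycle exists
-- because otherwise all edges are bridges, which forces q < p.
module Submission where

open import Defs
open import Algebra.Apartness.Bundles using (HeytingField)
open import Algebra.Bundles using (CommutativeRing)
open import Algebra.Module.Bundles using (Module)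
open import Algebra.Module.Morphism.Structures using (IsModuleIsomorphism)
import Algebra.Properties.AbelianGroup
import Algebra.Properties.Ring
import Algebra.Properties.Semiring.Sum
import Algebra.Solver.Ring.NaturalCoefficients.Default
open import Data.Bool.Base using (if_then_else_)
open import Data.Empty using (⊥-elim)
open import Data.Fin.Base using (Fin; zero; suc; inject₁; fromℕ; toℕ; punchIn)
open import Data.Fin.Properties using (_≟_; any?; inject₁-injective; fromℕ≢inject₁; suc-injective; toℕ-inject₁)
open import Data.List.Base using (List; []; _∷_; allFin)
open import Data.List.Membership.Propositional using () renaming (_∈_ to _∈ˡ_)
open import Data.List.Membership.Propositional.Properties using (∈-allFin)
open import Data.List.Relation.Unary.Any using (here; there)
open import Data.Nat.Base as ℕ using (ℕ; z≤n; s≤s; _%_; _∸_)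
import Data.Nat.Properties as ℕ
open import Data.Product.Base using (∃; _×_; _,_; proj₁; proj₂; map₂)
open import Data.Sum.Base using (_⊎_; inj₁; inj₂; map)
open import Data.Vec.Functional using (Vector; insertAt)
open import Data.Vec.Functional.Properties using (insertAt-lookup; insertAt-punchIn)
open import Function.Base using (_∘_)
open import Function.Bundles using (_⇔_; mk⇔; Equivalence)
open import Function.Definitions using (Injective)
open import Function.Properties.Equivalence using (⇔-isEquivalence)
open import Level using (Level; _⊔_)
import Relation.Binary.Construct.On as On
open import Relation.Binary.Construct.Closure.ReflexiveTransitive using (Star; ε; _◅_; _◅◅_)
open import Relation.Binary.Core using (Rel)
open import Relation.Binary.Definitions using (Decidable)
open import Relation.Binary.PropositionalEquality.Core as ≡ using (_≡_; _≢_)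
open import Relation.Binary.Structures using (IsEquivalence)
open import Relation.Nullary.Decidable using (dec-true; dec-false)
open import Relation.Nullary.Decidable.Core using (Dec; yes; no; does; _×-dec_; _⊎-dec_; map′; ¬?; decidable-stable)
open import Relation.Nullary.Negation.Core using (¬_; contradiction)

private variable
  a c ℓ m m′ ℓm ℓm′ : Level

-- Reachability, simple paths and cycles

module _ {p : ℕ} {_↝_ : Rel (Fin p) ℓ} (_↝?_ : Decidable _↝_) where

  private
    -- Warshall: only the vertices in the list may occur inside the walk.
    Via : List (Fin p) → Rel (Fin p) ℓ
    Via []       x y = x ≡ y ⊎ x ↝ y
    Via (z ∷ zs) x y = Via zs x y ⊎ (Via zs x z × Via zs z y)

    via? : ∀ zs → Decidable (Via zs)
    via? []       x y = (x ≟ y) ⊎-dec (x ↝? y)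
    via? (z ∷ zs) x y = via? zs x y ⊎-dec (via? zs x z ×-dec via? zs z y)

    via⇒star : ∀ zs {x y} → Via zs x y → Star _↝_ x y
    via⇒star []       (inj₁ ≡.refl)  = ε
    via⇒star []       (inj₂ x↝y)     = x↝y ◅ ε
    via⇒star (z ∷ zs) (inj₁ v)       = via⇒star zs v
    via⇒star (z ∷ zs) (inj₂ (v , w)) = via⇒star zs v ◅◅ via⇒star zs w

    via-weaken : ∀ zs {x y} → Via [] x y → Via zs x y
    via-weaken []       v = v
    via-weaken (z ∷ zs) v = inj₁ (via-weaken zs v)

    via-trans : ∀ zs {x y z} → z ∈ˡ zs → Via zs x z → Via zs z y → Via zs x y
    via-trans (z ∷ zs) (here ≡.refl) v w = inj₂ (to v , from w)
      where
      to : ∀ {x} → Via (z ∷ zs) x z → Via zs x z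
      to (inj₁ v)       = v
      to (inj₂ (v , _)) = v
      from : ∀ {y} → Via (z ∷ zs) z y → Via zs z y
      from (inj₁ v)       = v
      from (inj₂ (_ , v)) = v
    via-trans (_ ∷ zs) (there z∈) (inj₁ v)       (inj₁ w)       = inj₁ (via-trans zs z∈ v w)
    via-trans (_ ∷ zs) (there z∈) (inj₁ v)       (inj₂ (w , r)) = inj₂ (via-trans zs z∈ v w , r)
    via-trans (_ ∷ zs) (there z∈) (inj₂ (r , v)) (inj₁ w)       = inj₂ (r , via-trans zs z∈ v w)
    via-trans (_ ∷ zs) (there z∈) (inj₂ (r , _)) (inj₂ (_ , s)) = inj₂ (r , s)

    star⇒via : ∀ {x y} → Star _↝_ x y → Via (allFin p) x y
    star⇒via ε           = via-weaken (allFin p) (inj₁ ≡.refl)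
    star⇒via (x↝z ◅ z↝*y) =
      via-trans (allFin p) (∈-allFin _) (via-weaken (allFin p) (inj₂ x↝z)) (star⇒via z↝*y)

  star? : Decidable (Star _↝_)
  star? x y = map′ (via⇒star (allFin p)) star⇒via (via? (allFin p) x y)

record SimplePath {p} (_↝_ : Rel (Fin p) ℓ) (x y : Fin p) : Set ℓ where
  field
    steps     : ℕ
    vertex    : Fin (ℕ.suc steps) → Fin p
    injective : Injective _≡_ _≡_ vertex
    step      : ∀ i → vertex (inject₁ i) ↝ vertex (suc i)
    start     : vertex zero ≡ x
    end       : vertex (fromℕ steps) ≡ y

module _ {p} {_↝_ : Rel (Fin p) ℓ} where
  open SimplePath

  private
    suffix : ∀ {x y} (P : SimplePath _↝_ x y) i → SimplePath _↝_ (vertex P i) y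
    suffix P zero = record
      { steps = steps P ; vertex = vertex P ; injective = injective P
      ; step = step P ; start = ≡.refl ; end = end P }
    suffix record { steps = ℕ.suc n ; vertex = v ; injective = inj ; step = s ; end = e } (suc i) =
      suffix (record
        { steps = n ; vertex = v ∘ suc ; injective = λ eq → suc-injective (inj eq)
        ; step = s ∘ suc ; start = ≡.refl ; end = e }) i

    extend : ∀ {x y z} → x ↝ z → SimplePath _↝_ z y → SimplePath _↝_ x y
    extend {x} x↝z P with any? (λ i → vertex P i ≟ x)
    ... | yes (i , ≡.refl) = suffix P i
    ... | no  x∉P = record
      { steps = ℕ.suc (steps P) ; vertex = v ; injective = inj ; step = s
      ; start = ≡.refl ; end = end P }
      where
      v : Fin (2 ℕ.+ steps P) → Fin p
      v zero    = x
      v (suc i) = vertex P i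

      inj : Injective _≡_ _≡_ v
      inj {zero}  {zero}  eq = ≡.refl
      inj {zero}  {suc j} eq = contradiction (j , ≡.sym eq) x∉P
      inj {suc i} {zero}  eq = contradiction (i , eq) x∉P
      inj {suc i} {suc j} eq = ≡.cong suc (injective P eq)

      s : ∀ i → v (inject₁ i) ↝ v (suc i)
      s zero    = ≡.subst (x ↝_) (≡.sym (start P)) x↝z
      s (suc i) = step P i

  star⇒simplePath : ∀ {x y} → Star _↝_ x y → SimplePath _↝_ x y
  star⇒simplePath {x} ε = record
    { steps = 0 ; vertex = λ _ → x ; injective = λ { {zero} {zero} _ → ≡.refl }
    ; step = λ () ; start = ≡.refl ; end = ≡.refl }
  star⇒simplePath (x↝z ◅ z↝*y) = extend x↝z (star⇒simplePath z↝*y)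

module _ {A : Set a} {_∼_ : Rel A ℓ} (∼-isEquivalence : IsEquivalence _∼_) where
  open IsEquivalence ∼-isEquivalence

  chain : ∀ {n} (v : Fin (ℕ.suc n) → A) → (∀ i → v (inject₁ i) ∼ v (suc i)) → v zero ∼ v (fromℕ n)
  chain {ℕ.zero}  v s = refl
  chain {ℕ.suc n} v s = trans (s zero) (chain (v ∘ suc) (s ∘ suc))

  private
    before : ∀ {n} (v : Fin (ℕ.suc n) → A) i → (∀ j → j ≢ i → v (inject₁ j) ∼ v (suc j)) →
             v zero ∼ v (inject₁ i)
    before v zero    s = refl
    before v (suc i) s =
      trans (s zero λ ()) (before (v ∘ suc) i λ j j≢i → s (suc j) (j≢i ∘ suc-injective))

    after : ∀ {n} (v : Fin (ℕ.suc n) → A) i → (∀ j → j ≢ i → v (inject₁ j) ∼ v (suc j)) →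
            v (suc i) ∼ v (fromℕ n)
    after v zero    s = chain (v ∘ suc) λ j → s (suc j) λ ()
    after v (suc i) s = after (v ∘ suc) i λ j j≢i → s (suc j) (j≢i ∘ suc-injective)

  detour : ∀ {n} (v : Fin (ℕ.suc n) → A) i → (∀ j → j ≢ i → v (inject₁ j) ∼ v (suc j)) →
           v (fromℕ n) ∼ v zero → v (inject₁ i) ∼ v (suc i)
  detour v i s closing = sym (trans (after v i s) (trans closing (before v i s)))

module _ {p q} (G : Graph p q) where
  open Graph G

  ends-distinct : ∀ e → end₁ e ≢ end₂ e
  ends-distinct e eq = ℕ.<-irrefl (≡.cong toℕ eq) (ordered e)

  joins-ends : ∀ {e x y z w} → Joins e x y → Joins e z w → (x ≡ z × y ≡ w) ⊎ (x ≡ w × y ≡ z)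
  joins-ends (inj₁ (≡.refl , ≡.refl)) (inj₁ (≡.refl , ≡.refl)) = inj₁ (≡.refl , ≡.refl)
  joins-ends (inj₁ (≡.refl , ≡.refl)) (inj₂ (≡.refl , ≡.refl)) = inj₂ (≡.refl , ≡.refl)
  joins-ends (inj₂ (≡.refl , ≡.refl)) (inj₁ (≡.refl , ≡.refl)) = inj₂ (≡.refl , ≡.refl)
  joins-ends (inj₂ (≡.refl , ≡.refl)) (inj₂ (≡.refl , ≡.refl)) = inj₁ (≡.refl , ≡.refl)

  joins? : ∀ e x y → Dec (Joins e x y)
  joins? e x y = ((end₁ e ≟ x) ×-dec (end₂ e ≟ y)) ⊎-dec ((end₁ e ≟ y) ×-dec (end₂ e ≟ x))

  module _ (C : Cycle G) where
    open Cycle C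

    contains? : ∀ e → Dec (Contains e)
    contains? e = any? (λ i → joins? e (vertex (inject₁ i)) (vertex (suc i)))
                  ⊎-dec joins? e (vertex (fromℕ _)) (vertex zero)

    step≢close : ∀ i → proj₁ (step i) ≢ proj₁ close
    step≢close i eq with joins-ends (≡.subst (λ e → Joins e _ _) eq (proj₂ (step i))) (proj₂ close)
    ... | inj₁ (x , _) = fromℕ≢inject₁ (≡.sym (injective x))
    step≢close zero eq    | inj₂ (_ , y) with () ← injective y
    step≢close (suc i) eq | inj₂ (x , _) with () ← injective x

    step-injective : ∀ {i j} → proj₁ (step i) ≡ proj₁ (step j) → i ≡ j
    step-injective {i} {j} eq
      with joins-ends (≡.subst (λ e → Joins e _ _) eq (proj₂ (step i))) (proj₂ (step j))
    ... | inj₁ (x , _) = inject₁-injective (injective x)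
    ... | inj₂ (x , y) = contradiction i<i (ℕ.<-irrefl ≡.refl)
      where
      1+i≡j : ℕ.suc (toℕ i) ≡ toℕ j
      1+i≡j = ≡.trans (≡.cong toℕ (injective y)) (toℕ-inject₁ j)
      i≡1+j : toℕ i ≡ ℕ.suc (toℕ j)
      i≡1+j = ≡.trans (≡.sym (toℕ-inject₁ i)) (≡.cong toℕ (injective x))
      i<i : toℕ i ℕ.< toℕ i
      i<i = ℕ.<-trans (ℕ.≤-reflexive 1+i≡j) (ℕ.≤-reflexive (≡.sym i≡1+j))

    around : {_∼_ : Rel (Fin p) ℓ} → IsEquivalence _∼_ →
             ∀ e → (∀ f → f ≢ e → end₁ f ∼ end₂ f) → Contains e → end₁ e ∼ end₂ e
    around {_∼_ = _∼_} eqv e off-e = λ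
      { (inj₁ (i , e-i)) → joined⁻¹ e-i
          (detour eqv vertex i
            (λ j j≢i → off (step j) λ eq → j≢i (step-injective (≡.trans eq (joins-unique e-i (proj₂ (step i))))))
            (off close λ eq → step≢close i (≡.trans (joins-unique (proj₂ (step i)) e-i) (≡.sym eq))))
      ; (inj₂ e-c) → joined⁻¹ e-c (sym (chain eqv vertex λ j →
            off (step j) λ eq → step≢close j (≡.trans eq (joins-unique e-c (proj₂ close)))))
      }
      where
      open IsEquivalence eqv using (sym)

      joined⁻¹ : ∀ {x y} → Joins e x y → x ∼ y → end₁ e ∼ end₂ e
      joined⁻¹ (inj₁ (≡.refl , ≡.refl)) x∼y = x∼y
      joined⁻¹ (inj₂ (≡.refl , ≡.refl)) x∼y = sym x∼y

      off : ∀ {x y} (adj : Adjacent x y) → proj₁ adj ≢ e → x ∼ y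
      off (f , inj₁ (≡.refl , ≡.refl)) f≢e = off-e f f≢e
      off (f , inj₂ (≡.refl , ≡.refl)) f≢e = sym (off-e f f≢e)

  AdjacentOff : Fin q → Rel (Fin p) _
  AdjacentOff e x y = ∃ λ f → f ≢ e × Joins f x y

  reachableOff? : ∀ e → Decidable (Star (AdjacentOff e))
  reachableOff? e = star? λ x y → any? λ f → ¬? (f ≟ e) ×-dec joins? f x y

  nonBridge⇒cycle : ∀ e → Star (AdjacentOff e) (end₁ e) (end₂ e) → Cycle G
  nonBridge⇒cycle e e₁↝*e₂ with star⇒simplePath e₁↝*e₂
  ... | record { steps = 0 ; start = start ; end = end } =
    contradiction (≡.trans (≡.sym start) end) (ends-distinct e)
  ... | record { steps = 1 ; step = step ; start = start ; end = end } =
    let f , f≢e , f-ends = step zero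
    in contradiction (joins-unique (≡.subst₂ (Joins f) start end f-ends) (inj₁ (≡.refl , ≡.refl))) f≢e
  ... | record { steps = ℕ.suc (ℕ.suc n) ; vertex = vertex ; injective = injective
               ; step = step ; start = start ; end = end } = record
    { length-3  = n
    ; vertex    = vertex
    ; injective = injective
    ; step      = λ i → let f , _ , f-ends = step i in f , f-ends
    ; close     = e , inj₂ (≡.sym start , ≡.sym end)
    }

-- Linear algebra over a Heyting field

module _ {R : CommutativeRing c ℓ} {M : Module R m ℓm} {N : Module R m′ ℓm′} where
  private
    module M = Module M
    module N = Module N
    open CommutativeRing R using (0#)
    open Algebra.Properties.AbelianGroup M.+ᴹ-abelianGroup using () renaming (x∙y⁻¹≈ε⇒x≈y to x-y≈0⇒x≈y)
    open Algebra.Properties.AbelianGroup N.+ᴹ-abelianGroup using (inverseˡ-unique)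
    open import Relation.Binary.Reasoning.Setoid N.≈ᴹ-setoid

  linearBijection : {f : M.Carrierᴹ → N.Carrierᴹ} →
    (∀ {x y} → x M.≈ᴹ y → f x N.≈ᴹ f y) →
    (∀ x y → f (x M.+ᴹ y) N.≈ᴹ f x N.+ᴹ f y) →
    (∀ a x → f (a M.*ₗ x) N.≈ᴹ a N.*ₗ f x) →
    (∀ x → f x N.≈ᴹ N.0ᴹ → x M.≈ᴹ M.0ᴹ) →
    (∀ y → ∃ λ x → f x N.≈ᴹ y) →
    IsModuleIsomorphism M.rawModule N.rawModule f
  linearBijection {f} f-cong +-homo *ₗ-homo kernel≈0 onto = record
    { isModuleMonomorphism = record
      { isModuleHomomorphism = record
        { isBimoduleHomomorphism = record
          { +ᴹ-isGroupHomomorphism = record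
            { isMonoidHomomorphism = record
              { isMagmaHomomorphism = record
                { isRelHomomorphism = record { cong = f-cong }
                ; homo = +-homo
                }
              ; ε-homo = 0-homo
              }
            ; ⁻¹-homo = neg-homo
            }
          ; *ₗ-homo = *ₗ-homo
          ; *ᵣ-homo = λ a x → begin
              f (x M.*ᵣ a) ≈⟨ f-cong (M.*ₗ-*ᵣ-coincident a x) ⟨
              f (a M.*ₗ x) ≈⟨ *ₗ-homo a x ⟩
              a N.*ₗ f x   ≈⟨ N.*ₗ-*ᵣ-coincident a (f x) ⟩
              f x N.*ᵣ a   ∎
          }
        }
      ; injective = λ {x} {y} fx≈fy → x-y≈0⇒x≈y x y (kernel≈0 _ (begin
          f (x M.+ᴹ M.-ᴹ y)     ≈⟨ +-homo x (M.-ᴹ y) ⟩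
          f x N.+ᴹ f (M.-ᴹ y)   ≈⟨ N.+ᴹ-cong fx≈fy (neg-homo y) ⟩
          f y N.+ᴹ N.-ᴹ f y     ≈⟨ N.-ᴹ‿inverseʳ (f y) ⟩
          N.0ᴹ                  ∎))
      }
    ; surjective = λ y → let x , fx≈y = onto y in x , λ z≈x → N.≈ᴹ-trans (f-cong z≈x) fx≈y
    }
    where
    0-homo : f M.0ᴹ N.≈ᴹ N.0ᴹ
    0-homo = begin
      f M.0ᴹ             ≈⟨ f-cong (M.*ₗ-zeroˡ M.0ᴹ) ⟨
      f (0# M.*ₗ M.0ᴹ)   ≈⟨ *ₗ-homo 0# M.0ᴹ ⟩
      0# N.*ₗ f M.0ᴹ     ≈⟨ N.*ₗ-zeroˡ _ ⟩
      N.0ᴹ               ∎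

    neg-homo : ∀ x → f (M.-ᴹ x) N.≈ᴹ N.-ᴹ f x
    neg-homo x = inverseˡ-unique _ _ (begin
      f (M.-ᴹ x) N.+ᴹ f x   ≈⟨ +-homo (M.-ᴹ x) x ⟨
      f (M.-ᴹ x M.+ᴹ x)     ≈⟨ f-cong (M.-ᴹ‿inverseˡ x) ⟩
      f M.0ᴹ                ≈⟨ 0-homo ⟩
      N.0ᴹ                  ∎)

module LinearAlgebra {c ℓ₁ ℓ₂} (F : HeytingField c ℓ₁ ℓ₂) where
  R = fieldRing F
  open CommutativeRing R hiding (zero)
  open HeytingField F using (_#_; tight; #-cotrans; #⇒invertible; invertible⇒#)
  open Algebra.Properties.Semiring.Sum semiring
  open Algebra.Properties.Ring ring
  open import Algebra.Apartness.Properties.HeytingCommutativeRing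
    (HeytingField.heytingCommutativeRing F) using (1#0; x-0≈x; #-congʳ)
  open import Relation.Binary.Reasoning.Setoid setoid
  open Algebra.Solver.Ring.NaturalCoefficients.Default commutativeSemiring using (solve; _:=_; _:+_; _:*_)

  ¬#0⇒≈0 : ∀ {x} → ¬ x # 0# → x ≈ 0#
  ¬#0⇒≈0 {x} = proj₁ (tight x 0#)

  1≉0 : ¬ 1# ≈ 0#
  1≉0 1≈0 = proj₂ (tight 1# 0#) 1≈0 1#0

  #0⇒inverse : ∀ {x} → x # 0# → ∃ λ y → x * y ≈ 1#
  #0⇒inverse {x} x#0 with y , _ , [x-0]*y≈1 ← #⇒invertible x#0 =
    y , trans (*-congʳ (sym (x-0≈x x))) [x-0]*y≈1

  #0-cancelˡ : ∀ {x y} → x # 0# → x * y ≈ 0# → y ≈ 0#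
  #0-cancelˡ {x} {y} x#0 xy≈0 with z , xz≈1 ← #0⇒inverse x#0 = begin
    y           ≈⟨ *-identityˡ y ⟨
    1# * y      ≈⟨ *-congʳ xz≈1 ⟨
    x * z * y   ≈⟨ solve 3 (λ x y z → x :* z :* y := z :* (x :* y)) refl x y z ⟩
    z * (x * y) ≈⟨ *-congˡ xy≈0 ⟩
    z * 0#      ≈⟨ zeroʳ z ⟩
    0#          ∎

  ≉0-cancelˡ : ∀ {x y} → ¬ x ≈ 0# → x * y ≈ 0# → y ≈ 0#
  ≉0-cancelˡ x≉0 xy≈0 = ¬#0⇒≈0 λ y#0 → x≉0 (#0-cancelˡ y#0 (trans (*-comm _ _) xy≈0))

  x*x≈0⇒x≈0 : ∀ {x} → x * x ≈ 0# → x ≈ 0#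
  x*x≈0⇒x≈0 {x} xx≈0 = ¬#0⇒≈0 λ x#0 → proj₂ (tight x 0#) (#0-cancelˡ x#0 xx≈0) x#0

  +-zeroʳ-cancel : ∀ {x y} → y ≈ 0# → x + y ≈ 0# → x ≈ 0#
  +-zeroʳ-cancel y≈0 x+y≈0 = trans (sym (trans (+-congˡ y≈0) (+-identityʳ _))) x+y≈0

  sum-zero : ∀ {n} {f : Vector Carrier n} → (∀ i → f i ≈ 0#) → sum f ≈ 0#
  sum-zero {n} f≈0 = trans (sum-cong-≋ f≈0) (sum-replicate-zero n)

  +#0 : ∀ {x y} → x + y # 0# → x # 0# ⊎ y # 0#
  +#0 {x} {y} x+y#0 with #-cotrans x+y#0 y
  ... | inj₂ y#0   = inj₂ y#0
  ... | inj₁ x+y#y with z , z[x+y-y]≈1 , [x+y-y]z≈1 ← #⇒invertible x+y#y =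
    inj₁ (invertible⇒# (z , trans (*-congˡ x-0≈x+y-y) z[x+y-y]≈1
                          , trans (*-congʳ x-0≈x+y-y) [x+y-y]z≈1))
    where
    x-0≈x+y-y : x - 0# ≈ x + y - y
    x-0≈x+y-y = trans (x-0≈x x) (sym (//-rightDividesʳ y x))

  sum#0 : ∀ {n} (f : Vector Carrier n) → sum f # 0# → ∃ λ i → f i # 0#
  sum#0 {ℕ.zero}  f 0#0 = ⊥-elim (proj₂ (tight 0# 0#) refl 0#0)
  sum#0 {ℕ.suc n} f ∑f#0 with +#0 ∑f#0
  ... | inj₁ f₀#0 = zero , f₀#0
  ... | inj₂ ∑#0 with i , fᵢ#0 ← sum#0 (f ∘ suc) ∑#0 = suc i , fᵢ#0

  sum-δ : ∀ {n} (a : Vector Carrier n) j → ∑[ i < n ] (δ R j i * a i) ≈ a j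
  sum-δ a zero    = trans (+-cong (*-identityˡ _) (sum-zero λ i → zeroˡ (a (suc i)))) (+-identityʳ _)
  sum-δ a (suc j) = trans (+-cong (zeroˡ _) (sum-δ (a ∘ suc) j)) (+-identityˡ _)

  δ-sym : ∀ {n} (i j : Fin n) → δ R i j ≡ δ R j i
  δ-sym i j with i ≟ j | j ≟ i
  ... | yes _   | yes _   = ≡.refl
  ... | no  _   | no  _   = ≡.refl
  ... | yes i≡j | no  j≢i = contradiction (≡.sym i≡j) j≢i
  ... | no  i≢j | yes j≡i = contradiction (≡.sym j≡i) i≢j

  δ-refl : ∀ {n} (i : Fin n) → δ R i i ≡ 1#
  δ-refl i with i ≟ i
  ... | yes _   = ≡.refl
  ... | no  i≢i = contradiction ≡.refl i≢i

  δ-≢ : ∀ {n} {i j : Fin n} → i ≢ j → δ R i j ≡ 0#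
  δ-≢ {i = i} {j} i≢j with i ≟ j
  ... | yes i≡j = contradiction i≡j i≢j
  ... | no  _   = ≡.refl

  infix 8 _∙_
  _∙_ : ∀ {n} → Vector Carrier n → Vector Carrier n → Carrier
  _∙_ {n} u v = ∑[ i < n ] (u i * v i)

  combination : ∀ {m n} → Vector Carrier m → (Fin m → Vector Carrier n) → Vector Carrier n
  combination {m} a b x = ∑[ i < m ] (a i * b i x)

  Independent : ∀ {m n} → (Fin m → Vector Carrier n) → Set (c ⊔ ℓ₁)
  Independent b = ∀ a → (∀ x → combination a b x ≈ 0#) → ∀ i → a i ≈ 0#

  ∙-comm : ∀ {n} (u v : Vector Carrier n) → u ∙ v ≈ v ∙ u
  ∙-comm u v = sum-cong-≋ λ x → *-comm (u x) (v x)

  ∙-zeroʳ : ∀ {n} (u v : Vector Carrier n) → (∀ x → v x ≈ 0#) → u ∙ v ≈ 0#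
  ∙-zeroʳ u v v≈0 = sum-zero λ x → trans (*-congˡ (v≈0 x)) (zeroʳ (u x))

  ∙-distrib-+ : ∀ {n} (w u v : Vector Carrier n) → w ∙ (λ x → u x + v x) ≈ w ∙ u + w ∙ v
  ∙-distrib-+ w u v = trans (sum-cong-≋ λ x → distribˡ (w x) (u x) (v x))
                            (∑-distrib-+ (λ x → w x * u x) (λ x → w x * v x))

  +-∙-distrib : ∀ {n} (u v w : Vector Carrier n) → (λ x → u x + v x) ∙ w ≈ u ∙ w + v ∙ w
  +-∙-distrib u v w = trans (sum-cong-≋ λ x → distribʳ (w x) (u x) (v x))
                            (∑-distrib-+ (λ x → u x * w x) (λ x → v x * w x))

  ∙-combination : ∀ {m n} (w : Vector Carrier n) a (b : Fin m → Vector Carrier n) →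
                  w ∙ combination a b ≈ ∑[ i < m ] (a i * w ∙ b i)
  ∙-combination {m} {n} w a b = begin
    ∑[ x < n ] (w x * ∑[ i < m ] (a i * b i x))
      ≈⟨ sum-cong-≋ (λ x → *-distribˡ-sum (w x) λ i → a i * b i x) ⟩
    ∑[ x < n ] ∑[ i < m ] (w x * (a i * b i x))
      ≈⟨ ∑-comm (λ x i → w x * (a i * b i x)) ⟩
    ∑[ i < m ] ∑[ x < n ] (w x * (a i * b i x))
      ≈⟨ sum-cong-≋ (λ i → trans
           (sum-cong-≋ λ x → solve 3 (λ w a b → w :* (a :* b) := a :* (w :* b)) refl (w x) (a i) (b i x))
           (sym (*-distribˡ-sum (a i) λ x → w x * b i x))) ⟩
    ∑[ i < m ] (a i * w ∙ b i) ∎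

  -- Gaussian elimination with pivot b i zero ≠ 0, whose inverse is y.
  eliminate : ∀ {m n} (b : Fin (ℕ.suc m) → Vector Carrier (ℕ.suc n)) i y → b i zero * y ≈ 1# →
              Independent b →
              Independent λ j x → b (punchIn i j) (suc x) + - (b (punchIn i j) zero * y) * b i (suc x)
  eliminate {m} {n} b i y pivot indep a a·b′≈0 j =
    trans (reflexive (≡.sym (insertAt-punchIn a i aᵢ j))) (indep a⁺ a⁺·b≈0 (punchIn i j))
    where
    t : Vector Carrier m
    t j = - (b (punchIn i j) zero * y)

    aᵢ : Carrier
    aᵢ = ∑[ j < m ] (a j * t j)

    a⁺ : Vector Carrier (ℕ.suc m)
    a⁺ = insertAt a i aᵢ

    reduced : ∀ x → combination a⁺ b x ≈ ∑[ j < m ] (a j * (b (punchIn i j) x + t j * b i x))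
    reduced x = begin
      ∑[ k < ℕ.suc m ] (a⁺ k * b k x)
        ≈⟨ sum-remove (λ k → a⁺ k * b k x) ⟩
      a⁺ i * b i x + ∑[ j < m ] (a⁺ (punchIn i j) * b (punchIn i j) x)
        ≈⟨ +-cong (*-congʳ (reflexive (insertAt-lookup a i aᵢ)))
                  (sum-cong-≋ λ j → *-congʳ (reflexive (insertAt-punchIn a i aᵢ j))) ⟩
      aᵢ * b i x + ∑[ j < m ] (a j * b (punchIn i j) x)
        ≈⟨ +-comm _ _ ⟩
      ∑[ j < m ] (a j * b (punchIn i j) x) + aᵢ * b i x
        ≈⟨ +-congˡ (*-distribʳ-sum (b i x) λ j → a j * t j) ⟩
      ∑[ j < m ] (a j * b (punchIn i j) x) + ∑[ j < m ] (a j * t j * b i x)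
        ≈⟨ ∑-distrib-+ (λ j → a j * b (punchIn i j) x) (λ j → a j * t j * b i x) ⟨
      ∑[ j < m ] (a j * b (punchIn i j) x + a j * t j * b i x)
        ≈⟨ sum-cong-≋ (λ j → solve 4 (λ a b t d → a :* b :+ a :* t :* d := a :* (b :+ t :* d)) refl
                               (a j) (b (punchIn i j) x) (t j) (b i x)) ⟩
      ∑[ j < m ] (a j * (b (punchIn i j) x + t j * b i x)) ∎

    cleared : ∀ j → b (punchIn i j) zero + t j * b i zero ≈ 0#
    cleared j = begin
      d + - (d * y) * b i zero ≈⟨ +-congˡ (-‿distribˡ-* (d * y) (b i zero)) ⟨
      d - d * y * b i zero     ≈⟨ +-congˡ (-‿cong (trans (*-assoc d y (b i zero))
                                    (*-congˡ (trans (*-comm y (b i zero)) pivot)))) ⟩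
      d - d * 1#               ≈⟨ +-congˡ (-‿cong (*-identityʳ d)) ⟩
      d - d                    ≈⟨ -‿inverseʳ d ⟩
      0#                       ∎
      where d = b (punchIn i j) zero

    a⁺·b≈0 : ∀ x → combination a⁺ b x ≈ 0#
    a⁺·b≈0 zero    = trans (reduced zero) (sum-zero λ j → trans (*-congˡ (cleared j)) (zeroʳ (a j)))
    a⁺·b≈0 (suc x) = trans (reduced (suc x)) (a·b′≈0 x)

  -- Equality is undecidable, but m ≤ n is stable, so if it failed no entry of
  -- the first column could be apart from 0, and tightness would make them all 0.
  independent⇒≤ : ∀ {m n} (b : Fin m → Vector Carrier n) → Independent b → m ℕ.≤ n
  independent⇒≤ {ℕ.zero}          b indep = z≤n
  independent⇒≤ {ℕ.suc m} {ℕ.zero}  b indep = contradiction (indep (λ _ → 1#) (λ ()) zero) 1≉0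
  independent⇒≤ {ℕ.suc m} {ℕ.suc n} b indep = decidable-stable (_ ℕ.≤? _) λ m≰n →
    let
      column≈0 : ∀ i → b i zero ≈ 0#
      column≈0 i = ¬#0⇒≈0 λ bᵢ#0 → let y , pivot = #0⇒inverse bᵢ#0 in
        m≰n (s≤s (independent⇒≤ _ (eliminate b i y pivot indep)))

      all≈0 : ∀ a → (∀ x → combination a (λ i → b i ∘ suc) x ≈ 0#) → ∀ x → combination a b x ≈ 0#
      all≈0 a = λ { a·b≈0 zero → sum-zero λ i → trans (*-congˡ (column≈0 i)) (zeroʳ (a i))
                  ; a·b≈0 (suc x) → a·b≈0 x }
    in m≰n (ℕ.m≤n⇒m≤1+n (independent⇒≤ (λ i → b i ∘ suc) λ a a·b≈0 → indep a (all≈0 a a·b≈0)))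

  module _ {m n} {φ b : Fin m → Vector Carrier n} (dual : ∀ i j → φ i ∙ b j ≈ δ R j i) where

    dual-coordinate : ∀ a i → φ i ∙ combination a b ≈ a i
    dual-coordinate a i = begin
      φ i ∙ combination a b         ≈⟨ ∙-combination (φ i) a b ⟩
      ∑[ j < m ] (a j * φ i ∙ b j)  ≈⟨ sum-cong-≋ (λ j → trans (*-congˡ (dual i j))
                                         (trans (*-comm _ _) (*-congʳ (reflexive (δ-sym j i))))) ⟩
      ∑[ j < m ] (δ R i j * a j)    ≈⟨ sum-δ a i ⟩
      a i                           ∎

    dual⇒≤ : m ℕ.≤ n
    dual⇒≤ = independent⇒≤ b λ a a·b≈0 i →
      trans (sym (dual-coordinate a i)) (∙-zeroʳ (φ i) (combination a b) a·b≈0)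

    dual⇒< : ∀ k → (∀ i → φ i ∙ k ≈ 0#) → ∀ x → k x # 0# → m ℕ.< n
    dual⇒< k φ∙k≈0 x kₓ#0 = independent⇒≤ k∷b independent
      where
      k∷b : Fin (ℕ.suc m) → Vector Carrier n
      k∷b zero    = k
      k∷b (suc j) = b j

      independent : Independent k∷b
      independent a a·k∷b≈0 = λ { zero → a₀≈0 ; (suc i) → tail≈0 i }
        where
        tail≈0 : ∀ i → a (suc i) ≈ 0#
        tail≈0 i = begin
          a (suc i)
            ≈⟨ dual-coordinate (a ∘ suc) i ⟨
          φ i ∙ combination (a ∘ suc) b
            ≈⟨ +-identityˡ _ ⟨
          0# + φ i ∙ combination (a ∘ suc) b
            ≈⟨ +-congʳ (trans (*-congˡ (φ∙k≈0 i)) (zeroʳ (a zero))) ⟨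
          a zero * φ i ∙ k + φ i ∙ combination (a ∘ suc) b
            ≈⟨ +-congˡ (∙-combination (φ i) (a ∘ suc) b) ⟩
          a zero * φ i ∙ k + ∑[ j < m ] (a (suc j) * φ i ∙ b j)
            ≈⟨ ∙-combination (φ i) a k∷b ⟨
          φ i ∙ combination a k∷b
            ≈⟨ ∙-zeroʳ (φ i) (combination a k∷b) a·k∷b≈0 ⟩
          0# ∎

        a₀≈0 : a zero ≈ 0#
        a₀≈0 = #0-cancelˡ kₓ#0 (trans (*-comm _ _) (+-zeroʳ-cancel
          (sum-zero λ j → trans (*-congʳ (tail≈0 j)) (zeroˡ (b j x))) (a·k∷b≈0 x)))

  -- The projections k x of the basis vectors δ x to the common kernel of φ have
  -- total trace n − m = 1, so one of them has an entry apart from 0.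
  dual⇒kernel : ∀ {m n} {φ b : Fin m → Vector Carrier n} → (∀ i j → φ i ∙ b j ≈ δ R j i) →
                n ≡ ℕ.suc m → ∃ λ k → (∀ i → φ i ∙ k ≈ 0#) × ∃ λ x → k x # 0#
  dual⇒kernel {m} {φ = φ} {b} dual ≡.refl =
    let x , kₓ#0 = sum#0 (λ x → k x x) (#-congʳ (sym trace) 1#0)
    in k x , φ∙k≈0 x , x , kₓ#0
    where
    k : Fin (ℕ.suc m) → Vector Carrier (ℕ.suc m)
    k x y = δ R x y + combination (λ i → - φ i x) b y

    φ∙k≈0 : ∀ x i → φ i ∙ k x ≈ 0#
    φ∙k≈0 x i = begin
      φ i ∙ k x
        ≈⟨ ∙-distrib-+ (φ i) (δ R x) (combination (λ i → - φ i x) b) ⟩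
      φ i ∙ δ R x + φ i ∙ combination (λ i → - φ i x) b
        ≈⟨ +-cong (trans (∙-comm (φ i) (δ R x)) (sum-δ (φ i) x))
                  (dual-coordinate {φ = φ} {b} dual (λ i → - φ i x) i) ⟩
      φ i x - φ i x
        ≈⟨ -‿inverseʳ (φ i x) ⟩
      0# ∎

    diagonal : ∀ x → k x x + ∑[ i < m ] (φ i x * b i x) ≈ 1#
    diagonal x = begin
      δ R x x + combination (λ i → - φ i x) b x + ∑[ i < m ] (φ i x * b i x)
        ≈⟨ +-assoc _ _ _ ⟩
      δ R x x + (combination (λ i → - φ i x) b x + ∑[ i < m ] (φ i x * b i x))
        ≈⟨ +-congˡ (sym (∑-distrib-+ (λ i → - φ i x * b i x) (λ i → φ i x * b i x))) ⟩
      δ R x x + ∑[ i < m ] (- φ i x * b i x + φ i x * b i x)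
        ≈⟨ +-cong (reflexive (δ-refl x)) (sum-zero λ i →
             trans (+-congʳ (sym (-‿distribˡ-* (φ i x) (b i x)))) (-‿inverseˡ _)) ⟩
      1# + 0#
        ≈⟨ +-identityʳ 1# ⟩
      1# ∎

    trace : ∑[ x < ℕ.suc m ] k x x ≈ 1#
    trace = +-cancelʳ (∑[ i < m ] 1#) _ _ (begin
      ∑[ x < ℕ.suc m ] k x x + ∑[ i < m ] 1#
        ≈⟨ +-congˡ (sum-cong-≋ λ i → trans (dual i i) (reflexive (δ-refl i))) ⟨
      ∑[ x < ℕ.suc m ] k x x + ∑[ i < m ] ∑[ x < ℕ.suc m ] (φ i x * b i x)
        ≈⟨ +-congˡ (∑-comm λ i x → φ i x * b i x) ⟩
      ∑[ x < ℕ.suc m ] k x x + ∑[ x < ℕ.suc m ] ∑[ i < m ] (φ i x * b i x)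
        ≈⟨ ∑-distrib-+ (λ x → k x x) (λ x → ∑[ i < m ] (φ i x * b i x)) ⟨
      ∑[ x < ℕ.suc m ] (k x x + ∑[ i < m ] (φ i x * b i x))
        ≈⟨ sum-cong-≋ diagonal ⟩
      1# + ∑[ i < m ] 1# ∎)

  sum-row-δ : ∀ {n} (i : Fin n) → ∑[ j < n ] δ R i j ≈ 1#
  sum-row-δ i = trans (sum-cong-≋ λ j → sym (*-identityʳ (δ R i j))) (sum-δ (λ _ → 1#) i)

  bilinear-rankOne : ∀ {m n} (β : Fin m → Fin m → Vector Carrier n) (φ : Vector Carrier m) e →
    (∀ i j → β i j e ≈ φ i * φ j) → ∀ u v → bilinearExtension F β u v e ≈ (φ ∙ u) * (φ ∙ v)
  bilinear-rankOne {m} β φ e β≈φφ u v = begin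
    ∑[ i < m ] ∑[ j < m ] (u i * v j * β i j e)
      ≈⟨ sum-cong-≋ (λ i → trans
           (sum-cong-≋ λ j → trans (*-congˡ (β≈φφ i j))
             (solve 4 (λ u v a b → u :* v :* (a :* b) := a :* u :* (b :* v)) refl (u i) (v j) (φ i) (φ j)))
           (sym (*-distribˡ-sum (φ i * u i) λ j → φ j * v j))) ⟩
    ∑[ i < m ] (φ i * u i * (φ ∙ v))
      ≈⟨ *-distribʳ-sum (φ ∙ v) (λ i → φ i * u i) ⟨
    (φ ∙ u) * (φ ∙ v) ∎

  orthogonalProduct-δ : ∀ {n} (i j e : Fin n) → orthogonalProduct F i j e ≈ δ R e i * δ R e j
  orthogonalProduct-δ i j e with i ≟ j
  ... | no i≢j with e ≟ i
  ...   | yes ≡.refl = sym (trans (*-congˡ (reflexive (δ-≢ i≢j))) (zeroʳ _))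
  ...   | no  _      = sym (zeroˡ _)
  orthogonalProduct-δ i j e | yes ≡.refl with e ≟ i
  ...   | yes ≡.refl = trans (reflexive (δ-refl i)) (sym (*-identityˡ 1#))
  ...   | no  e≢i    = trans (reflexive (δ-≢ (e≢i ∘ ≡.sym))) (sym (zeroˡ 0#))

  𝒪-product : ∀ {n} (u v : Vector Carrier n) e →
              bilinearExtension F (orthogonalProduct F) u v e ≈ u e * v e
  𝒪-product u v e = trans
    (bilinear-rankOne (orthogonalProduct F) (δ R e) e (λ i j → orthogonalProduct-δ i j e) u v)
    (*-cong (sum-δ u e) (sum-δ v e))

  alternates : ∀ n (w : Fin (ℕ.suc n) → Carrier) → (∀ i → w (inject₁ i) + w (suc i) ≈ 0#) →
    (ℕ.suc n % 2 ≡ 1 × w (fromℕ n) ≈ w zero) ⊎ (ℕ.suc n % 2 ≡ 0 × w (fromℕ n) + w zero ≈ 0#)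
  alternates 0 w opposite = inj₁ (≡.refl , refl)
  alternates 1 w opposite = inj₂ (≡.refl , trans (+-comm _ _) (opposite zero))
  alternates (ℕ.suc (ℕ.suc n)) w opposite =
    map (map₂ λ same → trans same w₂≈w₀) (map₂ λ opp → trans (+-congˡ (sym w₂≈w₀)) opp)
        (alternates n (λ i → w (suc (suc i))) (λ i → opposite (suc (suc i))))
    where
    w₂≈w₀ : w (suc (suc zero)) ≈ w zero
    w₂≈w₀ = +-cancelˡ (w (suc zero)) _ _
      (trans (opposite (suc zero)) (trans (sym (opposite zero)) (+-comm _ _)))

-- The normal algebra of a graph

module GraphAlgebra {c ℓ₁ ℓ₂} (F : HeytingField c ℓ₁ ℓ₂) {p q} (G : Graph p q) where
  open LinearAlgebra F
  open CommutativeRing R hiding (zero)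
  open Algebra.Properties.Semiring.Sum semiring
  open Algebra.Properties.Ring ring
  open import Algebra.Apartness.Properties.HeytingCommutativeRing
    (HeytingField.heytingCommutativeRing F) using (1#0)
  open import Relation.Binary.Reasoning.Setoid setoid
  open Algebra.Solver.Ring.NaturalCoefficients.Default commutativeSemiring using (solve; _:=_; _:+_; _:*_)
  open Graph G

  T : Vector Carrier p → Vector Carrier q
  T u e = u (end₁ e) + u (end₂ e)

  incidence : Fin q → Vector Carrier p
  incidence e x = δ R (end₁ e) x + δ R (end₂ e) x

  incidence-∙ : ∀ e u → incidence e ∙ u ≈ T u e
  incidence-∙ e u = trans (+-∙-distrib (δ R (end₁ e)) (δ R (end₂ e)) u)
                          (+-cong (sum-δ u (end₁ e)) (sum-δ u (end₂ e)))

  incidence-end₁ : ∀ e → incidence e (end₁ e) ≈ 1#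
  incidence-end₁ e = trans (+-cong (reflexive (δ-refl (end₁ e)))
    (reflexive (δ-≢ (ends-distinct G e ∘ ≡.sym)))) (+-identityʳ 1#)

  incidence-end₂ : ∀ e → incidence e (end₂ e) ≈ 1#
  incidence-end₂ e = trans (+-cong (reflexive (δ-≢ (ends-distinct G e)))
    (reflexive (δ-refl (end₂ e)))) (+-identityˡ 1#)

  incidence-off : ∀ e x → end₁ e ≢ x → end₂ e ≢ x → incidence e x ≈ 0#
  incidence-off e x e₁≢x e₂≢x =
    trans (+-cong (reflexive (δ-≢ e₁≢x)) (reflexive (δ-≢ e₂≢x))) (+-identityˡ 0#)

  bracket-joins : ∀ {x y e} → Joins e x y → bracket F G x y e ≡ 1#
  bracket-joins {x} {y} {e} e-xy with adjacent? x y
  ... | no  ¬xy        = contradiction (e , e-xy) ¬xy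
  ... | yes (f , f-xy) = ≡.trans (≡.cong (δ R f) (joins-unique e-xy f-xy)) (δ-refl f)

  bracket-¬joins : ∀ {x y e} → ¬ Joins e x y → bracket F G x y e ≡ 0#
  bracket-¬joins {x} {y} {e} ¬e-xy with adjacent? x y
  ... | no  _          = ≡.refl
  ... | yes (f , f-xy) = δ-≢ {i = f} {e} λ { ≡.refl → ¬e-xy f-xy }

  bracket-end₁ : ∀ e y → bracket F G (end₁ e) y e ≡ δ R (end₂ e) y
  bracket-end₁ e y with end₂ e ≟ y
  ... | yes e₂≡y = bracket-joins (inj₁ (≡.refl , e₂≡y))
  ... | no  e₂≢y = bracket-¬joins λ
    { (inj₁ (_ , e₂≡y)) → e₂≢y e₂≡y ; (inj₂ (_ , e₂≡e₁)) → ends-distinct G e (≡.sym e₂≡e₁) }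

  bracket-end₂ : ∀ e y → bracket F G (end₂ e) y e ≡ δ R (end₁ e) y
  bracket-end₂ e y with end₁ e ≟ y
  ... | yes e₁≡y = bracket-joins (inj₂ (e₁≡y , ≡.refl))
  ... | no  e₁≢y = bracket-¬joins λ
    { (inj₁ (e₁≡e₂ , _)) → ends-distinct G e e₁≡e₂ ; (inj₂ (e₁≡y , _)) → e₁≢y e₁≡y }

  bracket-off : ∀ e x y → end₁ e ≢ x → end₂ e ≢ x → bracket F G x y e ≡ 0#
  bracket-off e x y e₁≢x e₂≢x = bracket-¬joins λ
    { (inj₁ (e₁≡x , _)) → e₁≢x e₁≡x ; (inj₂ (_ , e₂≡x)) → e₂≢x e₂≡x }

  vertexProduct-refl : ∀ x → vertexProduct F G x x ≡ λ e → ∑[ z < p ] bracket F G x z e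
  vertexProduct-refl x with x ≟ x
  ... | yes _   = ≡.refl
  ... | no  x≢x = contradiction ≡.refl x≢x

  vertexProduct-≢ : ∀ {x y} → x ≢ y → vertexProduct F G x y ≡ bracket F G x y
  vertexProduct-≢ {x} {y} x≢y with x ≟ y
  ... | yes x≡y = contradiction x≡y x≢y
  ... | no  _   = ≡.refl

  vertexProduct-incidence : ∀ x y e → vertexProduct F G x y e ≈ incidence e x * incidence e y
  vertexProduct-incidence x y e = cases (end₁ e ≟ x) (end₂ e ≟ x) (x ≟ y)
    where
    cases : ∀ {x y} → Dec (end₁ e ≡ x) → Dec (end₂ e ≡ x) → Dec (x ≡ y) →
            vertexProduct F G x y e ≈ incidence e x * incidence e y
    cases (yes ≡.refl) _ (yes ≡.refl) = begin
      vertexProduct F G (end₁ e) (end₁ e) e               ≡⟨ ≡.cong (λ v → v e) (vertexProduct-refl (end₁ e)) ⟩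
      ∑[ z < p ] bracket F G (end₁ e) z e                 ≈⟨ sum-cong-≋ (λ z → reflexive (bracket-end₁ e z)) ⟩
      ∑[ z < p ] δ R (end₂ e) z                           ≈⟨ sum-row-δ (end₂ e) ⟩
      1#                                                  ≈⟨ *-identityʳ 1# ⟨
      1# * 1#                                             ≈⟨ *-cong (incidence-end₁ e) (incidence-end₁ e) ⟨
      incidence e (end₁ e) * incidence e (end₁ e)         ∎
    cases {y = y} (yes ≡.refl) _ (no e₁≢y) = begin
      vertexProduct F G (end₁ e) y e                      ≡⟨ ≡.cong (λ v → v e) (vertexProduct-≢ e₁≢y) ⟩
      bracket F G (end₁ e) y e                            ≡⟨ bracket-end₁ e y ⟩
      δ R (end₂ e) y                                      ≈⟨ +-identityˡ _ ⟨
      0# + δ R (end₂ e) y                                 ≡⟨ ≡.cong (_+ δ R (end₂ e) y) (δ-≢ e₁≢y) ⟨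
      incidence e y                                       ≈⟨ *-identityˡ _ ⟨
      1# * incidence e y                                  ≈⟨ *-congʳ (incidence-end₁ e) ⟨
      incidence e (end₁ e) * incidence e y                ∎
    cases (no _) (yes ≡.refl) (yes ≡.refl) = begin
      vertexProduct F G (end₂ e) (end₂ e) e               ≡⟨ ≡.cong (λ v → v e) (vertexProduct-refl (end₂ e)) ⟩
      ∑[ z < p ] bracket F G (end₂ e) z e                 ≈⟨ sum-cong-≋ (λ z → reflexive (bracket-end₂ e z)) ⟩
      ∑[ z < p ] δ R (end₁ e) z                           ≈⟨ sum-row-δ (end₁ e) ⟩
      1#                                                  ≈⟨ *-identityʳ 1# ⟨
      1# * 1#                                             ≈⟨ *-cong (incidence-end₂ e) (incidence-end₂ e) ⟨
      incidence e (end₂ e) * incidence e (end₂ e)         ∎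
    cases {y = y} (no _) (yes ≡.refl) (no e₂≢y) = begin
      vertexProduct F G (end₂ e) y e                      ≡⟨ ≡.cong (λ v → v e) (vertexProduct-≢ e₂≢y) ⟩
      bracket F G (end₂ e) y e                            ≡⟨ bracket-end₂ e y ⟩
      δ R (end₁ e) y                                      ≈⟨ +-identityʳ _ ⟨
      δ R (end₁ e) y + 0#                                 ≡⟨ ≡.cong (δ R (end₁ e) y +_) (δ-≢ e₂≢y) ⟨
      incidence e y                                       ≈⟨ *-identityˡ _ ⟨
      1# * incidence e y                                  ≈⟨ *-congʳ (incidence-end₂ e) ⟨
      incidence e (end₂ e) * incidence e y                ∎
    cases {x} (no e₁≢x) (no e₂≢x) (yes ≡.refl) = trans
      (trans (reflexive (≡.cong (λ v → v e) (vertexProduct-refl x)))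
             (sum-zero λ z → reflexive (bracket-off e x z e₁≢x e₂≢x)))
      (sym (trans (*-congʳ (incidence-off e x e₁≢x e₂≢x)) (zeroˡ _)))
    cases {x} {y} (no e₁≢x) (no e₂≢x) (no x≢y) = trans
      (reflexive (≡.trans (≡.cong (λ v → v e) (vertexProduct-≢ x≢y)) (bracket-off e x y e₁≢x e₂≢x)))
      (sym (trans (*-congʳ (incidence-off e x e₁≢x e₂≢x)) (zeroˡ _)))

  𝒩-product : ∀ u v e → bilinearExtension F (vertexProduct F G) u v e ≈ T u e * T v e
  𝒩-product u v e = trans
    (bilinear-rankOne (vertexProduct F G) (incidence e) e (λ x y → vertexProduct-incidence x y e) u v)
    (*-cong (incidence-∙ e u) (incidence-∙ e v))

  T-cong : ∀ {u v} → (∀ x → u x ≈ v x) → ∀ e → T u e ≈ T v e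
  T-cong u≈v e = +-cong (u≈v (end₁ e)) (u≈v (end₂ e))

  T-+ : ∀ u v e → T (λ x → u x + v x) e ≈ T u e + T v e
  T-+ u v e = solve 4 (λ a b c d → a :+ b :+ (c :+ d) := a :+ c :+ (b :+ d)) refl
                (u (end₁ e)) (v (end₁ e)) (u (end₂ e)) (v (end₂ e))

  T-* : ∀ a u e → T (λ x → a * u x) e ≈ a * T u e
  T-* a u e = sym (distribˡ a (u (end₁ e)) (u (end₂ e)))

  T-zero : ∀ u → (∀ x → u x ≈ 0#) → ∀ e → T u e ≈ 0#
  T-zero u u≈0 e = trans (+-cong (u≈0 (end₁ e)) (u≈0 (end₂ e))) (+-identityˡ 0#)

  T-joins : ∀ u {e x y} → Joins e x y → T u e ≈ u x + u y
  T-joins u (inj₁ (≡.refl , ≡.refl)) = refl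
  T-joins u (inj₂ (≡.refl , ≡.refl)) = +-comm _ _

  -- The edge e is u² exactly when T u has squared entries δ e, so rescaling u by
  -- T u e = ±1 gives a preimage of δ e.
  edgeSquare⇒section : EdgeSquare F G → ∀ e → ∃ λ s → ∀ f → T s f ≈ δ R e f
  edgeSquare⇒section square e with (u , _) , _ , _ , uu≈e ← square e =
    (λ x → T u e * u x) , λ f → trans (T-* (T u e) u f) (entry f)
    where
    squares : ∀ f → T u f * T u f ≈ δ R e f
    squares f = trans (sym (𝒩-product u u f)) (uu≈e f)

    entry : ∀ f → T u e * T u f ≈ δ R e f
    entry f with e ≟ f
    ... | yes ≡.refl = trans (squares e) (reflexive (δ-refl e))
    ... | no  e≢f    = trans
      (*-congˡ (x*x≈0⇒x≈0 (trans (squares f) (reflexive (δ-≢ e≢f))))) (zeroʳ _)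

  VanishesTogether : Vector Carrier p → Fin p → Fin p → Set ℓ₁
  VanishesTogether u x y = u x ≈ 0# ⇔ u y ≈ 0#

  T≈0⇒vanishesTogether : ∀ u e → T u e ≈ 0# → VanishesTogether u (end₁ e) (end₂ e)
  T≈0⇒vanishesTogether u e Tu≈0 =
    mk⇔ (λ u₁≈0 → +-zeroʳ-cancel u₁≈0 (trans (+-comm _ _) Tu≈0)) (λ u₂≈0 → +-zeroʳ-cancel u₂≈0 Tu≈0)

  vanishing-spreads : Connected G → ∀ u → (∀ e → VanishesTogether u (end₁ e) (end₂ e)) →
                      ∀ {x} → u x ≈ 0# → ∀ y → u y ≈ 0#
  vanishing-spreads (_ , connected) u together {x} uₓ≈0 y = along (connected x y) uₓ≈0
    where
    along : ∀ {x} → Star Adjacent x y → u x ≈ 0# → u y ≈ 0#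
    along ε                                        uₓ≈0 = uₓ≈0
    along ((e , inj₁ (≡.refl , ≡.refl)) ◅ walk) uₓ≈0 = along walk (Equivalence.to (together e) uₓ≈0)
    along ((e , inj₂ (≡.refl , ≡.refl)) ◅ walk) uₓ≈0 = along walk (Equivalence.from (together e) uₓ≈0)

  signed : Fin q → Vector Carrier p
  signed e x = δ R (end₁ e) x + - δ R (end₂ e) x

  signed-∙ : ∀ e u → signed e ∙ u ≈ u (end₁ e) - u (end₂ e)
  signed-∙ e u = begin
    signed e ∙ u
      ≈⟨ +-∙-distrib (δ R (end₁ e)) (λ x → - δ R (end₂ e) x) u ⟩
    δ R (end₁ e) ∙ u + ∑[ x < p ] (- δ R (end₂ e) x * u x)
      ≈⟨ +-cong (sum-δ u (end₁ e)) (sum-cong-≋ λ x →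
           trans (sym (-‿distribˡ-* (δ R (end₂ e) x) (u x))) (-‿distribʳ-* (δ R (end₂ e) x) (u x))) ⟩
    u (end₁ e) + δ R (end₂ e) ∙ (λ x → - u x)
      ≈⟨ +-congˡ (sum-δ (λ x → - u x) (end₂ e)) ⟩
    u (end₁ e) - u (end₂ e) ∎

  -- If every edge e were a bridge, the indicator functions of the sides of the
  -- bridges would be dual to the signed incidence functionals, which all vanish
  -- on constants.
  bridges⇒q<p : Fin p → (∀ e → ¬ Star (AdjacentOff G e) (end₁ e) (end₂ e)) → q ℕ.< p
  bridges⇒q<p x bridge = dual⇒< {φ = signed} {side} dual (λ _ → 1#)
    (λ e → trans (signed-∙ e (λ _ → 1#)) (-‿inverseʳ 1#)) x 1#0
    where
    side : Fin q → Vector Carrier p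
    side e x = if does (reachableOff? G e (end₁ e) x) then 1# else 0#

    side-in : ∀ e {x} → Star (AdjacentOff G e) (end₁ e) x → side e x ≡ 1#
    side-in e r = ≡.cong (if_then 1# else 0#) (dec-true (reachableOff? G e (end₁ e) _) r)

    side-out : ∀ e {x} → ¬ Star (AdjacentOff G e) (end₁ e) x → side e x ≡ 0#
    side-out e ¬r = ≡.cong (if_then 1# else 0#) (dec-false (reachableOff? G e (end₁ e) _) ¬r)

    side-across : ∀ e f → f ≢ e → side e (end₁ f) ≡ side e (end₂ f)
    side-across e f f≢e = cases (reachableOff? G e (end₁ e) (end₁ f))
      where
      cases : Dec (Star (AdjacentOff G e) (end₁ e) (end₁ f)) → side e (end₁ f) ≡ side e (end₂ f)
      cases (yes r) = ≡.trans (side-in e r)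
        (≡.sym (side-in e (r ◅◅ ((f , f≢e , inj₁ (≡.refl , ≡.refl)) ◅ ε))))
      cases (no ¬r) = ≡.trans (side-out e ¬r)
        (≡.sym (side-out e λ r → ¬r (r ◅◅ ((f , f≢e , inj₂ (≡.refl , ≡.refl)) ◅ ε))))

    dual : ∀ f e → signed f ∙ side e ≈ δ R e f
    dual f e with e ≟ f
    ... | yes ≡.refl = begin
      signed e ∙ side e                  ≈⟨ signed-∙ e (side e) ⟩
      side e (end₁ e) - side e (end₂ e)  ≡⟨ ≡.cong₂ _-_ (side-in e ε) (side-out e (bridge e)) ⟩
      1# - 0#                            ≈⟨ trans (+-congˡ -0#≈0#) (+-identityʳ 1#) ⟩
      1#                                 ∎
    ... | no e≢f = begin
      signed f ∙ side e                  ≈⟨ signed-∙ f (side e) ⟩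
      side e (end₁ f) - side e (end₂ f)  ≡⟨ ≡.cong (_- side e (end₂ f)) (side-across e f (e≢f ∘ ≡.sym)) ⟩
      side e (end₂ f) - side e (end₂ f)  ≈⟨ -‿inverseʳ _ ⟩
      0#                                 ∎

  p≤q⇒cycle : Fin p → p ℕ.≤ q → Cycle G
  p≤q⇒cycle x p≤q with any? (λ e → reachableOff? G e (end₁ e) (end₂ e))
  ... | yes (e , r) = nonBridge⇒cycle G e r
  ... | no  ¬r      = contradiction (bridges⇒q<p x λ e r → ¬r (e , r)) (ℕ.≤⇒≯ p≤q)

  module _ (char≢2 : ¬ (1# + 1# ≈ 0#)) (connected : Connected G) (square : EdgeSquare F G) where

    section : Fin q → Vector Carrier p
    section e = proj₁ (edgeSquare⇒section square e)

    T-section : ∀ e f → T (section e) f ≈ δ R e f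
    T-section e = proj₂ (edgeSquare⇒section square e)

    T-section-off : ∀ {e f} → e ≢ f → T (section e) f ≈ 0#
    T-section-off {e} {f} e≢f = trans (T-section e f) (reflexive (δ-≢ e≢f))

    section-dual : ∀ f e → incidence f ∙ section e ≈ δ R e f
    section-dual f e = trans (incidence-∙ f (section e)) (T-section e f)

    T-combination : ∀ a e → T (combination a section) e ≈ a e
    T-combination a e = trans (sym (incidence-∙ e (combination a section)))
      (dual-coordinate {φ = incidence} {section} section-dual a e)

    kernel-spreads : ∀ u → (∀ e → T u e ≈ 0#) → ∀ {x} → u x ≈ 0# → ∀ y → u y ≈ 0#
    kernel-spreads u Tu≈0 = vanishing-spreads connected u λ e → T≈0⇒vanishesTogether u e (Tu≈0 e)

    q≤p : q ℕ.≤ p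
    q≤p = dual⇒≤ {φ = incidence} {section} section-dual

    p≤1+q : Fin p → p ℕ.≤ ℕ.suc q
    p≤1+q r = independent⇒≤ rows λ a a·rows≈0 → kernel-spreads a
      (λ e → trans (sym (incidence-∙ e a)) (trans (∙-comm (incidence e) a) (a·rows≈0 (suc e))))
      {r} (trans (sym (sum-δ a r)) (trans (∙-comm (δ R r) a) (a·rows≈0 zero)))
      where
      rows : Fin p → Vector Carrier (ℕ.suc q)
      rows x zero    = δ R r x
      rows x (suc e) = incidence e x

    x+x≈0⇒x≈0 : ∀ {x} → x + x ≈ 0# → x ≈ 0#
    x+x≈0⇒x≈0 {x} x+x≈0 = ≉0-cancelˡ char≢2 (trans (distribʳ x 1# 1#)
      (trans (+-cong (*-identityˡ x) (*-identityˡ x)) x+x≈0))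

    module _ (C : Cycle G) where
      open Cycle C

      private
        e₀ = proj₁ close

      -- A preimage of the closing edge alternates in sign along all other edges
      -- of the cycle, so on an even cycle it would have sum 0 on the closing edge.
      cycle-odd : length % 2 ≡ 1
      cycle-odd with alternates _ (section e₀ ∘ vertex) (λ i →
        trans (sym (T-joins (section e₀) (proj₂ (step i))))
              (T-section-off (step≢close G C i ∘ ≡.sym)))
      ... | inj₁ (odd , _) = odd
      ... | inj₂ (_ , opposite) = contradiction (begin
        1#                  ≡⟨ δ-refl e₀ ⟨
        δ R e₀ e₀           ≈⟨ T-section e₀ e₀ ⟨
        T (section e₀) e₀   ≈⟨ T-joins (section e₀) (proj₂ close) ⟩
        _                   ≈⟨ opposite ⟩
        0#                  ∎) 1≉0

      cycle-vanishes : ∀ u → (∀ e → Contains e → T u e ≈ 0#) → u (vertex zero) ≈ 0#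
      cycle-vanishes u Tu≈0 with alternates _ (u ∘ vertex) (λ i →
        trans (sym (T-joins u (proj₂ (step i)))) (Tu≈0 _ (inj₁ (i , proj₂ (step i)))))
      ... | inj₁ (_ , same) = x+x≈0⇒x≈0 (trans (+-congʳ (sym same))
        (trans (sym (T-joins u (proj₂ close))) (Tu≈0 _ (inj₂ (proj₂ close)))))
      ... | inj₂ (even , _) with () ← ≡.trans (≡.sym cycle-odd) even

    -- If e lay on C but not on D, the preimage of e would vanish on the odd cycle
    -- D, hence everywhere, because removing e does not disconnect G.
    cycle-⊆ : ∀ C D e → Cycle.Contains C e → Cycle.Contains D e
    cycle-⊆ C D e e∈C = decidable-stable (contains? G D e) λ e∉D →
      1≉0 (trans (reflexive (≡.sym (δ-refl e))) (trans (sym (T-section e e)) (T-zero u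
        (vanishing-spreads connected u together (cycle-vanishes D u λ f f∈D →
          T-section-off λ { ≡.refl → e∉D f∈D })) e)))
      where
      u = section e

      off-e : ∀ f → f ≢ e → VanishesTogether u (end₁ f) (end₂ f)
      off-e f f≢e = T≈0⇒vanishesTogether u f (T-section-off (f≢e ∘ ≡.sym))

      together : ∀ f → VanishesTogether u (end₁ f) (end₂ f)
      together f with f ≟ e
      ... | no  f≢e    = off-e f f≢e
      ... | yes ≡.refl = around G C (On.isEquivalence (λ x → u x ≈ 0#) ⇔-isEquivalence) f off-e e∈C

    unicyclic : Fin p → p ℕ.≤ q → Unicyclic G × HasOddCycle G
    unicyclic r p≤q = (connected , C , λ D e → mk⇔ (cycle-⊆ C D e) (cycle-⊆ D C e)) , C , cycle-odd C
      where C = p≤q⇒cycle r p≤q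

    ann⇒kernel : ∀ u → u ∈ ann F G → ∀ e → T (proj₁ u) e ≈ 0#
    ann⇒kernel (u , _) (_ , u·U≈0) e = begin
      T u e                                                     ≈⟨ *-identityʳ _ ⟨
      T u e * 1#                                                ≡⟨ ≡.cong (T u e *_) (δ-refl e) ⟨
      T u e * δ R e e                                           ≈⟨ *-congˡ (T-section e e) ⟨
      T u e * T (section e) e                                   ≈⟨ 𝒩-product u (section e) e ⟨
      bilinearExtension F (vertexProduct F G) u (section e) e
        ≈⟨ proj₂ (u·U≈0 (section e , λ _ → 0#) (_ , λ _ → refl)) e ⟩
      0#                                                        ∎

    module _ (p≤q : p ℕ.≤ q) where

      kernel-trivial : ∀ u → (∀ e → T u e ≈ 0#) → ∀ x → u x ≈ 0#
      kernel-trivial u Tu≈0 x = ¬#0⇒≈0 λ uₓ#0 → ℕ.≤⇒≯ p≤q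
        (dual⇒< {φ = incidence} {section} section-dual u
          (λ e → trans (incidence-∙ e u) (Tu≈0 e)) x uₓ#0)

      𝒩≅𝒪 : 𝒩 F G ≅ 𝒪 F q
      𝒩≅𝒪 = record
        { to          = λ (u , z) → T u , z
        ; isLinearIso = linearBijection
            {M = NormalAlgebra.space (𝒩 F G)} {N = NormalAlgebra.space (𝒪 F q)}
            (λ (u≈v , z≈w) → T-cong u≈v , z≈w)
            (λ (u , _) (v , _) → T-+ u v , λ _ → refl)
            (λ a (u , _) → T-* a u , λ _ → refl)
            (λ (u , _) (Tu≈0 , z≈0) → kernel-trivial u Tu≈0 , z≈0)
            (λ (a , z) → (combination a section , z) , T-combination a , λ _ → refl)
        ; ·-homo      = λ (u , _) (v , _) → T-zero (λ _ → 0#) (λ _ → refl) ,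
            λ e → trans (𝒩-product u v e) (sym (𝒪-product (T u) (T v) e))
        ; U-into      = λ (_ , z≈0) → _ , z≈0
        ; U-onto      = λ {(a , z)} (_ , z≈0) →
            (combination a section , z) , (_ , z≈0) , T-combination a , λ _ → refl
        ; Z-into      = λ {(u , _)} (u≈0 , _) → T-zero u u≈0 , _
        ; Z-onto      = λ {(a , z)} (a≈0 , _) → ((λ _ → 0#) , z) , ((λ _ → refl) , _) ,
            (λ e → trans (T-zero (λ _ → 0#) (λ _ → refl) e) (sym (a≈0 e))) , λ _ → refl
        }

      ann-dimension-0 : HasDimension (ann F G) 0
      ann-dimension-0 = (λ ()) , record
        { member      = λ ()
        ; independent = λ _ _ ()
        ; spanning    = λ u u∈ann → (λ ()) ,
            kernel-trivial (proj₁ u) (ann⇒kernel u u∈ann) , proj₂ (proj₁ u∈ann)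
        }

    module _ (p≡1+q : p ≡ ℕ.suc q) where

      normalised-kernel : ∃ λ k → (∀ e → T k e ≈ 0#) × ∃ λ r → k r ≈ 1#
      normalised-kernel
        with k , φ∙k≈0 , r , kᵣ#0 ← dual⇒kernel {φ = incidence} {section} section-dual p≡1+q
        with y , kᵣy≈1 ← #0⇒inverse kᵣ#0 =
          (λ x → y * k x) ,
          (λ e → trans (T-* y k e) (trans (*-congˡ (trans (sym (incidence-∙ e k)) (φ∙k≈0 e))) (zeroʳ y))) ,
          r , trans (*-comm y (k r)) kᵣy≈1

      k : Vector Carrier p
      k = proj₁ normalised-kernel

      Tk≈0 : ∀ e → T k e ≈ 0#
      Tk≈0 = proj₁ (proj₂ normalised-kernel)

      root : Fin p
      root = proj₁ (proj₂ (proj₂ normalised-kernel))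

      k-root : k root ≈ 1#
      k-root = proj₂ (proj₂ (proj₂ normalised-kernel))

      isTree : IsTree G
      isTree = connected , λ C → 1≉0 (trans (sym k-root)
        (kernel-spreads k Tk≈0 (cycle-vanishes C k λ e _ → Tk≈0 e) root))

      T-shift : ∀ u a e → T (λ x → u x + a * k x) e ≈ T u e
      T-shift u a e = begin
        T (λ x → u x + a * k x) e    ≈⟨ T-+ u (λ x → a * k x) e ⟩
        T u e + T (λ x → a * k x) e  ≈⟨ +-congˡ (trans (T-* a k e) (trans (*-congˡ (Tk≈0 e)) (zeroʳ a))) ⟩
        T u e + 0#                   ≈⟨ +-identityʳ _ ⟩
        T u e                        ∎

      shift-root : ∀ (u : Vector Carrier p) a → u root + a * k root ≈ u root + a
      shift-root u a = +-congˡ (trans (*-congˡ k-root) (*-identityʳ a))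

      preimage : Carrier → Vector Carrier q → Vector Carrier p
      preimage t a x = combination a section x + (t - combination a section root) * k x

      preimage-root : ∀ t a → preimage t a root ≈ t
      preimage-root t a = trans (shift-root (combination a section) (t - combination a section root))
        (trans (+-comm _ _) (//-rightDividesˡ (combination a section root) t))

      T-preimage : ∀ t a e → T (preimage t a) e ≈ a e
      T-preimage t a e = trans (T-shift (combination a section) _ e) (T-combination a e)

      𝒩≅𝔽⁰⊕𝒪 : 𝒩 F G ≅ 𝔽⁰ F ⊕ 𝒪 F q
      𝒩≅𝔽⁰⊕𝒪 = record
        { to          = λ (u , z) → u root , T u , z
        ; isLinearIso = linearBijection
            {M = NormalAlgebra.space (𝒩 F G)} {N = NormalAlgebra.space (𝔽⁰ F ⊕ 𝒪 F q)}
            (λ (u≈v , z≈w) → u≈v root , T-cong u≈v , z≈w)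
            (λ (u , _) (v , _) → refl , T-+ u v , λ _ → refl)
            (λ a (u , _) → refl , T-* a u , λ _ → refl)
            (λ (u , _) (uᵣ≈0 , Tu≈0 , z≈0) → kernel-spreads u Tu≈0 uᵣ≈0 , z≈0)
            (λ (t , a , z) → (preimage t a , z) , preimage-root t a , T-preimage t a , λ _ → refl)
        ; ·-homo      = λ (u , _) (v , _) → refl , T-zero (λ _ → 0#) (λ _ → refl) ,
            λ e → trans (𝒩-product u v e) (sym (𝒪-product (T u) (T v) e))
        ; U-into      = λ (_ , z≈0) → _ , _ , z≈0
        ; U-onto      = λ {(t , a , z)} (_ , _ , z≈0) →
            (preimage t a , z) , (_ , z≈0) , preimage-root t a , T-preimage t a , λ _ → refl
        ; Z-into      = λ {(u , _)} (u≈0 , _) → u≈0 root , T-zero u u≈0 , _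
        ; Z-onto      = λ {(t , a , z)} (t≈0 , a≈0 , _) → ((λ _ → 0#) , z) , ((λ _ → refl) , _) ,
            sym t≈0 , (λ e → trans (T-zero (λ _ → 0#) (λ _ → refl) e) (sym (a≈0 e))) , λ _ → refl
        }

      ann-dimension-1 : HasDimension (ann F G) 1
      ann-dimension-1 = (λ _ → k , λ _ → 0#) , record
        { member      = λ _ → (_ , λ _ → refl) , λ (v , _) _ → (λ _ → refl) ,
            λ e → trans (𝒩-product k v e) (trans (*-congʳ (Tk≈0 e)) (zeroˡ _))
        ; independent = λ { a (ak≈0 , _) zero → begin
            a zero                 ≈⟨ *-identityʳ _ ⟨
            a zero * 1#            ≈⟨ *-congˡ k-root ⟨
            a zero * k root        ≈⟨ +-identityʳ _ ⟨
            a zero * k root + 0#   ≈⟨ ak≈0 root ⟩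
            0#                     ∎ }
        ; spanning    = λ u u∈ann → (λ _ → proj₁ u root) ,
            (λ x → trans (multiple (proj₁ u) (ann⇒kernel u u∈ann) x) (sym (+-identityʳ _))) ,
            λ e → trans (proj₂ (proj₁ u∈ann) e) (sym (trans (+-identityʳ _) (zeroʳ _)))
        }
        where
        multiple : ∀ u → (∀ e → T u e ≈ 0#) → ∀ x → u x ≈ u root * k x
        multiple u Tu≈0 x = x∙y⁻¹≈ε⇒x≈y _ _ (trans (+-congˡ (-‿distribˡ-* (u root) (k x)))
          (kernel-spreads (λ y → u y + - u root * k y)
            (λ e → trans (T-shift u (- u root) e) (Tu≈0 e))
            {root} (trans (shift-root u (- u root)) (-‿inverseʳ (u root))) x))

theorem6p3 : ∀ {c ℓ₁ ℓ₂} (F : HeytingField c ℓ₁ ℓ₂) →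
    (let open HeytingField F) → ¬ (1# + 1# ≈ 0#) →
    ∀ {p q : ℕ} (G : Graph p q) → Connected G → EdgeSquare F G →
    (q ≡ p ∸ 1 ⊎ q ≡ p) ×
    (q ≡ p ∸ 1 → (𝒩 F G ≅ 𝔽⁰ F ⊕ 𝒪 F (p ∸ 1)) × HasDimension (ann F G) 1 × IsTree G) ×
    (q ≡ p → (𝒩 F G ≅ 𝒪 F p) × HasDimension (ann F G) 0 × Unicyclic G × HasOddCycle G)
theorem6p3 F char≢2 {ℕ.suc n} {q} G connected square = size , tree , cyclic
  where
  open GraphAlgebra F

  size : q ≡ n ⊎ q ≡ ℕ.suc n
  size with ℕ.m≤n⇒m<n∨m≡n (q≤p G char≢2 connected square)
  ... | inj₁ (s≤s q≤n) = inj₁ (ℕ.≤-antisym q≤n (ℕ.s≤s⁻¹ (p≤1+q G char≢2 connected square zero)))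
  ... | inj₂ q≡1+n     = inj₂ q≡1+n

  tree : q ≡ n → (𝒩 F G ≅ 𝔽⁰ F ⊕ 𝒪 F n) × HasDimension (ann F G) 1 × IsTree G
  tree ≡.refl = 𝒩≅𝔽⁰⊕𝒪 G char≢2 connected square ≡.refl ,
                ann-dimension-1 G char≢2 connected square ≡.refl ,
                isTree G char≢2 connected square ≡.refl

  cyclic : q ≡ ℕ.suc n → (𝒩 F G ≅ 𝒪 F (ℕ.suc n)) × HasDimension (ann F G) 0 × Unicyclic G × HasOddCycle G
  cyclic ≡.refl = 𝒩≅𝒪 G char≢2 connected square ℕ.≤-refl ,
                  ann-dimension-0 G char≢2 connected square ℕ.≤-refl ,
                  unicyclic G char≢2 connected square zero ℕ.≤-refl
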